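{- Let $\lambda$ be an integer partition, let $\mathcal{P}=\mathcal{P}(\lambda)$, let $N$ be the number of cells in the border strip $B(\lambda)$, and let $C$ be the number of corner cells in $B(\lambda)$. Then $\dim I_T(\mathcal{P})=\dim A_T(\mathcal{P})=N-C$.
   Context: An integer partition is a finite non-increasing sequence $\lambda=(\lambda_1,\dots,\lambda_\ell)$ of positive integers. Its Ferrers diagram is $F(\lambda)=\{(i,j):1\le i\le\ell,\ 1\le j\le\lambda_i\}$. The border strip is $B(\lambda)=\{(i,j)\in F(\lambda):(i+1,j+1)\notin F(\lambda)\}$. A cell $(i,j)\in B(\lambda)$ is a corner cell if $(i+1,j)\in B(\lambda)$ and $(i,j+1)\in B(\lambda)$. The poset $\mathcal{P}(\lambda)$ has underlying set $F(\lambda)$ with $(i,j)\preceq(k,m)$ iff $i\le k$ and $j\le m$. For a finite poset $\mathcal{P}$, $\mathcal{J}(\mathcal{P})$ is the set of order ideals (down-closed subsets) of $\mathcal{P}$. For $p\in\mathcal{P}$ define real-valued functions on $\mathcal{J}(\mathcal{P})$: $\mathbf{1}_p(I)=1$ if $p\in I$ and $0$ otherwise; $\mathcal{T}_p^-(I)=1$ if $p$ is a maximal element of $I$ and $0$ otherwise; $\mathcal{T}_p^+(I)=1$ if $p\notin I$ and $I\cup\{p\}\in\mathcal{J}(\mathcal{P})$, and $0$ otherwise; $\mathcal{T}_p=\mathcal{T}_p^+-\mathcal{T}_p^-$. The toggleability spaces are the real vector spaces $I_T(\mathcal{P})=\mathrm{Span}_{\mathbb{R}}(\mathbf{1}_p\mid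 p\in\mathcal{P})\cap\mathrm{Span}_{\mathbb{R}}(\{1\}\cup\{\mathcal{T}_p\mid p\in\mathcal{P}\})$ and $A_T(\mathcal{P})=\mathrm{Span}_{\mathbb{R}}(\mathcal{T}_p^-\mid p\in\mathcal{P})\cap\mathrm{Span}_{\mathbb{R}}(\{1\}\cup\{\mathcal{T}_p\mid p\in\mathcal{P}\})$, where $1$ is the constant function. -}

module Defs where

open import Level using (Level; _⊔_; 0ℓ) renaming (suc to lsuc)
open import Algebra.Apartness.Bundles using (HeytingCommutativeRing; HeytingField)
open import Algebra.Bundles using (CommutativeRing)
import Algebra.Definitions.RawMonoid as RawMonoidDefinitions
open import Data.Bool.Base using (if_then_else_)
open import Data.Fin.Base using (Fin; zero; suc; toℕ)
open import Data.Fin.Properties using (any?; all?; toℕ<n) renaming (_≟_ to _≟ᶠ_)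
open import Data.Fin.Subset using (Subset; _∈_; _∉_; _∪_; ⁅_⁆)
open import Data.Fin.Subset.Properties using (_∈?_)
open import Data.List.Base
  using (List; _∷_; length; lookup; filter; applyUpTo; cartesianProduct)
open import Data.List.Membership.Propositional using () renaming (_∈_ to _∈ˡ_)
open import Data.List.Membership.Propositional.Properties
  using (∈-lookup; ∈-filter⁺; ∈-filter⁻; ∈-cartesianProduct⁺; ∈-applyUpTo⁺)
open import Data.List.Properties using (length-filter)
import Data.List.Relation.Unary.All as All
open import Data.List.Relation.Unary.All using (All)
open import Data.List.Relation.Unary.AllPairs using (_∷_)
open import Data.List.Relation.Unary.Linked using (Linked)
open import Data.List.Relation.Unary.Unique.Propositional using (Unique)
import Data.List.Relation.Unary.Unique.Propositional.Properties as Unique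
open import Data.Nat.ListAction using (sum)
open import Data.Nat.Base using (ℕ; suc; _≤_; _≥_; s≤s)
open import Data.Nat.Properties
  using (_≟_; _≤?_; ≤-trans; ≤-isPartialOrder; m≤m+n; m≤n+m; <⇒≢; suc-injective)
open import Data.Product.Base using (_×_; _,_; ∃; Σ-syntax; proj₂)
open import Data.Product.Relation.Binary.Pointwise.NonDependent
  using (Pointwise; ×-isPartialOrder; ×-decidable; ≡×≡⇒≡)
open import Data.Sum.Base using (_⊎_)
open import Data.Vec.Functional using (Vector) renaming (_∷_ to _∷ᵛ_)
open import Function.Base using (const; _on_; _∘_)
open import Function.Bundles using (_⇔_; mk⇔)
open import Relation.Binary.Core using (Rel)
open import Relation.Binary.PropositionalEquality
  using (_≡_; refl; sym; cong; isEquivalence)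
open import Relation.Binary.Structures
  using (IsPartialOrder; IsDecPartialOrder; IsStrictPartialOrder)
open import Relation.Nullary.Decidable using (Dec; does; _×-dec_; _→-dec_; ¬?)
open import Relation.Nullary.Negation using (¬_; contradiction)
open import Relation.Unary using (Pred; Decidable; _≐_; _∩_)

-- The library has no real numbers.  ℝ is axiomatised, as in constructive
-- analysis, as a Cauchy-complete Archimedean ordered Heyting field (classically
-- this determines ℝ up to unique isomorphism); results are stated for every
-- model of these axioms.
record RealField (c ℓ₁ ℓ₂ ℓ₃ : Level) : Set (lsuc (c ⊔ ℓ₁ ⊔ ℓ₂ ⊔ ℓ₃)) where
  field
    heytingField : HeytingField c ℓ₁ ℓ₂

  open HeytingField heytingField public
  open HeytingCommutativeRing heytingCommutativeRing public using (commutativeRing)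
  open CommutativeRing commutativeRing public using (+-rawMonoid)
  open RawMonoidDefinitions +-rawMonoid public
    using () renaming (_×_ to _·_; sum to ∑)

  infix 4 _<_
  field
    _<_                  : Rel Carrier ℓ₃
    isStrictPartialOrder : IsStrictPartialOrder _≈_ _<_
    #⇒<⊎>                : ∀ {x y} → x # y → x < y ⊎ y < x
    <⇒#                  : ∀ {x y} → x < y → x # y
    +-monoˡ-<            : ∀ {x y} z → x < y → x + z < y + z
    *-pos                : ∀ {x y} → 0# < x → 0# < y → 0# < x * y
    archimedean          : ∀ x → ∃ λ n → x < n · 1#

  -- Both notions below say |x - y| < ε without using an absolute value.
  Cauchy : (ℕ → Carrier) → Set (c ⊔ ℓ₃)
  Cauchy s = ∀ ε → 0# < ε →
    ∃ λ n₀ → ∀ m n → n₀ ≤ m → n₀ ≤ n → s m < s n + ε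

  _⟶_ : (ℕ → Carrier) → Carrier → Set (c ⊔ ℓ₃)
  s ⟶ x = ∀ ε → 0# < ε →
    ∃ λ n₀ → ∀ n → n₀ ≤ n → s n < x + ε × x < s n + ε

  field
    complete : ∀ s → Cauchy s → ∃ λ x → s ⟶ x

module LinearAlgebra {c ℓ₁ ℓ₂ ℓ₃} (ℝ : RealField c ℓ₁ ℓ₂ ℓ₃) {X : Set} where

  open RealField ℝ hiding (refl; sym)

  linearCombination : ∀ {n} → Vector Carrier n → Vector (X → Carrier) n → X → Carrier
  linearCombination a v x = ∑ λ i → a i * v i x

  Span : ∀ {n} → Vector (X → Carrier) n → Pred (X → Carrier) (c ⊔ ℓ₁)
  Span {n} v f = Σ[ a ∈ Vector Carrier n ] (∀ x → f x ≈ linearCombination a v x)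

  LinearlyIndependent : ∀ {n} → Vector (X → Carrier) n → Set (c ⊔ ℓ₁)
  LinearlyIndependent v =
    ∀ a → (∀ x → linearCombination a v x ≈ 0#) → ∀ i → a i ≈ 0#

  record HasDimension {ℓ} (W : Pred (X → Carrier) ℓ) (d : ℕ) : Set (c ⊔ ℓ₁ ⊔ ℓ) where
    field
      basis       : Vector (X → Carrier) d
      independent : LinearlyIndependent basis
      spans       : W ≐ Span basis

-- Finite posets have underlying set Fin size, so that subsets are the
-- library's Subset size.
record FinitePoset : Set₁ where
  infix 4 _≼_
  field
    size              : ℕ
    _≼_               : Rel (Fin size) 0ℓ
    isDecPartialOrder : IsDecPartialOrder _≡_ _≼_

  open IsDecPartialOrder isDecPartialOrder public using () renaming (_≤?_ to _≼?_)

module OrderIdeals (P : FinitePoset) where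

  open FinitePoset P

  DownClosed : Pred (Subset size) 0ℓ
  DownClosed S = ∀ p q → p ≼ q → q ∈ S → p ∈ S

  downClosed? : Decidable DownClosed
  downClosed? S = all? λ p → all? λ q → (p ≼? q) →-dec ((q ∈? S) →-dec (p ∈? S))

  record OrderIdeal : Set where
    constructor ideal
    field
      members    : Subset size
      downClosed : DownClosed members

  open OrderIdeal public

  Maximal : Fin size → OrderIdeal → Set
  Maximal p I = p ∈ members I × (∀ q → q ∈ members I → p ≼ q → p ≡ q)

  maximal? : ∀ p I → Dec (Maximal p I)
  maximal? p I =
    (p ∈? members I) ×-dec
    all? λ q → (q ∈? members I) →-dec ((p ≼? q) →-dec (p ≟ᶠ q))

  Addable : Fin size → OrderIdeal → Set
  Addable p I = p ∉ members I × DownClosed (members I ∪ ⁅ p ⁆)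

  addable? : ∀ p I → Dec (Addable p I)
  addable? p I = ¬? (p ∈? members I) ×-dec downClosed? (members I ∪ ⁅ p ⁆)

module Toggleability {c ℓ₁ ℓ₂ ℓ₃} (ℝ : RealField c ℓ₁ ℓ₂ ℓ₃) (P : FinitePoset) where

  open RealField ℝ hiding (refl; sym)
  open FinitePoset P
  open OrderIdeals P
  open LinearAlgebra ℝ {OrderIdeal}

  χ : ∀ {A : Set} → Dec A → Carrier
  χ A? = if does A? then 1# else 0#

  𝟏 𝒯⁻ 𝒯⁺ 𝒯 : Fin size → OrderIdeal → Carrier
  𝟏  p I = χ (p ∈? members I)
  𝒯⁻ p I = χ (maximal? p I)
  𝒯⁺ p I = χ (addable? p I)
  𝒯  p I = 𝒯⁺ p I - 𝒯⁻ p I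

  I_T A_T : Pred (OrderIdeal → Carrier) (c ⊔ ℓ₁)
  I_T = Span 𝟏  ∩ Span (const 1# ∷ᵛ 𝒯)
  A_T = Span 𝒯⁻ ∩ Span (const 1# ∷ᵛ 𝒯)

record Partition : Set where
  field
    parts         : List ℕ
    positive      : All (1 ≤_) parts
    nonIncreasing : Linked _≥_ parts

module Ferrers (lam : Partition) where

  open Partition lam

  Cell : Set
  Cell = ℕ × ℕ

  -- Cells are 1-indexed, whereas lookup is 0-indexed.
  InDiagram : Pred Cell 0ℓ
  InDiagram (i , j) =
    Σ[ k ∈ Fin (length parts) ] (i ≡ suc (toℕ k) × 1 ≤ j × j ≤ lookup parts k)

  inDiagram? : Decidable InDiagram
  inDiagram? (i , j) =
    any? λ k → (i ≟ suc (toℕ k)) ×-dec ((1 ≤? j) ×-dec (j ≤? lookup parts k))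

  InBorder : Pred Cell 0ℓ
  InBorder (i , j) = InDiagram (i , j) × ¬ InDiagram (suc i , suc j)

  inBorder? : Decidable InBorder
  inBorder? (i , j) = inDiagram? (i , j) ×-dec ¬? (inDiagram? (suc i , suc j))

  IsCorner : Pred Cell 0ℓ
  IsCorner (i , j) = InBorder (i , j) × InBorder (suc i , j) × InBorder (i , suc j)

  isCorner? : Decidable IsCorner
  isCorner? (i , j) =
    inBorder? (i , j) ×-dec (inBorder? (suc i , j) ×-dec inBorder? (i , suc j))

  -- A box containing the diagram; see ∈-cells⇔InDiagram.
  box : List Cell
  box = cartesianProduct (applyUpTo suc (length parts)) (applyUpTo suc (sum parts))

  cells borderStrip corners : List Cell
  cells       = filter inDiagram? box
  borderStrip = filter inBorder? cells
  corners     = filter isCorner? borderStrip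

  corners≤borderStrip : length corners ≤ length borderStrip
  corners≤borderStrip = length-filter isCorner? borderStrip

  private
    lookup≤sum : ∀ ns (k : Fin (length ns)) → lookup ns k ≤ sum ns
    lookup≤sum (n ∷ ns) zero    = m≤m+n n (sum ns)
    lookup≤sum (n ∷ ns) (suc k) = ≤-trans (lookup≤sum ns k) (m≤n+m (sum ns) n)

    lookup-injective : ∀ {A : Set} {xs : List A} → Unique xs →
                       ∀ i j → lookup xs i ≡ lookup xs j → i ≡ j
    lookup-injective (x∉ ∷ u) zero    zero    eq = refl
    lookup-injective (x∉ ∷ u) zero (suc j) eq =
      contradiction eq (All.lookup x∉ (∈-lookup j))
    lookup-injective (x∉ ∷ u) (suc i) zero eq =
      contradiction (sym eq) (All.lookup x∉ (∈-lookup i))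
    lookup-injective (x∉ ∷ u) (suc i) (suc j) eq = cong suc (lookup-injective u i j eq)

    ∈-box : ∀ {x} → InDiagram x → x ∈ˡ box
    ∈-box {_ , suc j} (k , refl , s≤s _ , j≤) =
      ∈-cartesianProduct⁺ (∈-applyUpTo⁺ suc (toℕ<n k))
                          (∈-applyUpTo⁺ suc (≤-trans j≤ (lookup≤sum parts k)))

  ∈-cells⇔InDiagram : ∀ {x} → x ∈ˡ cells ⇔ InDiagram x
  ∈-cells⇔InDiagram = mk⇔ (proj₂ ∘ ∈-filter⁻ inDiagram? {xs = box})
                          (λ x∈F → ∈-filter⁺ inDiagram? (∈-box x∈F) x∈F)

  cells-unique : Unique cells
  cells-unique = Unique.filter⁺ inDiagram?
    (Unique.cartesianProduct⁺ (distinct (length parts)) (distinct (sum parts)))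
    where
    distinct : ∀ n → Unique (applyUpTo suc n)
    distinct n = Unique.applyUpTo⁺₁ suc n λ i<j _ → <⇒≢ i<j ∘ suc-injective

  cell : Fin (length cells) → Cell
  cell = lookup cells

  cell-injective : ∀ p q → cell p ≡ cell q → p ≡ q
  cell-injective = lookup-injective cells-unique

  _⊑_ : Rel Cell 0ℓ
  _⊑_ = Pointwise _≤_ _≤_

  -- By ∈-cells⇔InDiagram and cell-injective, cell is a bijection from the
  -- underlying set of 𝒫 onto the Ferrers diagram.
  𝒫 : FinitePoset
  𝒫 = record
    { size = length cells
    ; _≼_  = _⊑_ on cell
    ; isDecPartialOrder = record
      { isPartialOrder = record
        { isPreorder = record
          { isEquivalence = isEquivalence
          ; reflexive     = λ { refl → ⊑.refl }
          ; trans         = ⊑.trans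
          }
        ; antisym = λ {p} {q} p≤q q≤p →
            cell-injective p q (≡×≡⇒≡ (⊑.antisym p≤q q≤p))
        }
      ; _≟_  = _≟ᶠ_
      ; _≤?_ = λ p q → ×-decidable _≤?_ _≤?_ (cell p) (cell q)
      }
    }
    where
    module ⊑ = IsPartialOrder (×-isPartialOrder ≤-isPartialOrder ≤-isPartialOrder)

{-# OPTIONS --safe #-}
module Submission where

open import Algebra.Bundles using (CommutativeRing)
import Algebra.Properties.AbelianGroup as AbelianGroupProperties
import Algebra.Properties.CommutativeMonoid.Mult as CommutativeMonoidMult
import Algebra.Properties.Monoid.Mult as MonoidMult
import Algebra.Properties.Ring as RingProperties
import Algebra.Properties.Semiring.Mult as SemiringMult
import Algebra.Properties.Semiring.Mult.TCOptimised as OptimisedMult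
import Algebra.Properties.Semiring.Sum as SemiringSum
import Algebra.Solver.Ring as RingSolver
open import Algebra.Solver.Ring.AlmostCommutativeRing
  using (fromCommutativeRing; _-Raw-AlmostCommutative⟶_)
open import Data.Bool.Base using (true; false; if_then_else_)
open import Data.Empty using (⊥)
open import Data.Fin.Base as Fin using (Fin; zero; suc; toℕ)
import Data.Fin.Properties as Fin
open import Data.Fin.Subset using (Subset; _∈_; _∪_; ⁅_⁆)
open import Data.Fin.Subset.Properties using (_∈?_; x∈p∪q⁻; x∈p∪q⁺; x∈⁅x⁆; x∈⁅y⁆⇒x≡y)
open import Data.Integer.Base as ℤ using (ℤ; +_; -[1+_]; _⊖_; _◃_)
import Data.Integer.Properties as ℤ
open import Data.List.Base as List
  using (List; []; _∷_; _++_; length; lookup; filter; applyUpTo; cartesianProduct)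
open import Data.List.Membership.Propositional.Properties
  using (∈-lookup; ∈-filter⁺; ∈-filter⁻; ∈-cartesianProduct⁻; ∈-applyUpTo⁻)
import Data.List.Relation.Unary.All as All
open import Data.List.Relation.Unary.AllPairs using (AllPairs; _∷_)
import Data.List.Relation.Unary.Any as Any
import Data.List.Relation.Unary.Any.Properties as Any
open import Data.List.Relation.Unary.Linked.Properties using (Linked⇒AllPairs)
open import Data.List.Relation.Unary.Unique.Propositional using (Unique)
import Data.List.Relation.Unary.Unique.Propositional.Properties as Unique
import Data.Maybe.Base as Maybe
open import Data.Nat.Base as ℕ
  using (ℕ; zero; suc; _∸_; _≤_; _≥_; _≡ᵇ_; z≤n; s≤s; pred)
open import Data.Nat.ListAction using () renaming (sum to sumℕ)
open import Data.Nat.Properties as ℕ using (≤-refl; ≤-trans; n≤1+n; m≤n⇒m<n∨m≡n; <-cmp)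
open import Data.Product.Base using (_×_; _,_; ∃; Σ-syntax; proj₁; proj₂)
open import Data.Sign.Base as Sign using (Sign)
open import Data.Sum.Base as Sum using (_⊎_; inj₁; inj₂)
open import Data.Unit.Base using (⊤; tt)
open import Data.Vec.Base using (tabulate)
open import Data.Vec.Functional using (Vector) renaming (_∷_ to _∷ᵛ_)
open import Data.Vec.Properties using (lookup∘tabulate; lookup⇒[]=; []=⇒lookup)
open import Function.Base using (_∘_)
open import Function.Bundles using (Equivalence)
open import Level using (_⊔_)
open import Relation.Binary.Definitions using (tri<; tri≈; tri>)
open import Relation.Binary.PropositionalEquality as ≡ using (_≡_; _≢_)
import Relation.Binary.Reasoning.Setoid as SetoidReasoning
open import Relation.Binary.Structures using (IsStrictPartialOrder)
open import Relation.Nullary.Decidable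
  using (Dec; yes; no; does; dec⇒maybe; dec-true; _×-dec_; _⊎-dec_; ¬?)
open import Relation.Nullary.Negation using (¬_; contradiction)
open import Relation.Unary using (Pred; Decidable)
open import Defs

-- Write 1ᵢⱼ for the indicator of a cell (0-indexed) and uᵢⱼ = max(1ᵢ₊₁ⱼ , 1ᵢⱼ₊₁), functions of the
-- order ideal.  Then 𝒯⁻ = 1ᵢⱼ - uᵢⱼ and 𝒯⁺ = 1ᵢ₋₁ⱼ 1ᵢⱼ₋₁ - 1ᵢⱼ = 1ᵢ₋₁ⱼ + 1ᵢⱼ₋₁ - uᵢ₋₁ⱼ₋₁ - 1ᵢⱼ, so
-- summation by parts gives, for every b : ℕ² → ℝ vanishing at the boxes that can be added to λ,
--   ∑ b 𝒯 = b₀₀ + ∑ (bᵢ₊₁ⱼ + bᵢⱼ₊₁ - 2 bᵢⱼ) 1ᵢⱼ + ∑ (bᵢⱼ - bᵢ₊₁ⱼ₊₁) uᵢⱼ.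
-- Elements of I_T therefore correspond to the b that are constant along diagonals, and elements
-- of A_T to those with bᵢⱼ + bᵢ₊₁ⱼ₊₁ = bᵢ₊₁ⱼ + bᵢⱼ₊₁ on λ.  In both cases b is determined by one
-- value per diagonal, taken outside λ in the second case, subject to vanishing on the diagonals
-- that end in a corner cell; these are N - C free parameters.  Conversely, the coefficients in a
-- relation between 1, 1ᵢⱼ and uᵢⱼ are found by adding a cell to a suitable ideal.  The 𝒯 are
-- independent of each other and of 1 because a relation forces b to be an arithmetic progression
-- along the first column and row which vanishes at both ends.

-- Every diagonal that meets λ has exactly one border cell, its last one, so N counts diagonals.
-- That cell is a corner exactly when the next box of its diagonal can be added to λ, and such a
-- diagonal loses its parameter. The obstacle is that the functions 1ᵢⱼ and uᵢⱼ are not independent: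
-- if only one of (i + 1 , j) and (i , j + 1) lies in λ, then uᵢⱼ is the indicator of that cell, and
-- if neither does, it is zero. The coefficient of uᵢⱼ can be isolated only where both lie in λ.
-- There, adding (i , j + 1) to an ideal changes uᵢⱼ just when (i + 1 , j) is absent, so doing this
-- once with and once without (i + 1 , j) gives two relations that differ by the coefficient. At the
-- remaining cells, which are the border cells other than corners, a parameter survives. For A_T it
-- is not a value of b on λ but the value at (i + 1 , j + 1) outside λ, which does not affect the
-- sum of b 𝒯 and can be chosen to make the coefficient of uᵢⱼ match as well.

-- Integer coefficients for the ring solver

module IntegerCoefficients {c ℓ} (R : CommutativeRing c ℓ) where

  open CommutativeRing R
  open OptimisedMult semiring using (1+×; ×-homo-+; ×1-homo-*) renaming (_×_ to _·_)
  open AbelianGroupProperties +-abelianGroup using (⁻¹-∙-comm)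
  open RingProperties ring using (-0#≈0#; -‿involutive; -‿distribˡ-*; -‿distribʳ-*)
  open SetoidReasoning setoid

  -- Equality in R need not be decidable, so constants are normalised in ℤ. With the optimised
  -- multiples, `con (+ 1)` evaluates to `1#` itself.
  ⟦_⟧ : ℤ → Carrier
  ⟦ + n ⟧      = n · 1#
  ⟦ -[1+ n ] ⟧ = - (suc n · 1#)

  private
    ⊖-homo : ∀ m n → ⟦ m ⊖ n ⟧ ≈ m · 1# - n · 1#
    ⊖-homo zero    zero    = sym (-‿inverseʳ 0#)
    ⊖-homo zero    (suc n) = sym (+-identityˡ _)
    ⊖-homo (suc m) zero    = sym (trans (+-congˡ -0#≈0#) (+-identityʳ _))
    ⊖-homo (suc m) (suc n) = begin
      ⟦ suc m ⊖ suc n ⟧                    ≡⟨ ≡.cong ⟦_⟧ (ℤ.[1+m]⊖[1+n]≡m⊖n m n) ⟩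
      ⟦ m ⊖ n ⟧                            ≈⟨ ⊖-homo m n ⟩
      m · 1# - n · 1#                      ≈⟨ +-congʳ (+-identityʳ _) ⟨
      m · 1# + 0# - n · 1#                 ≈⟨ +-congʳ (+-congˡ (-‿inverseʳ 1#)) ⟨
      m · 1# + (1# - 1#) - n · 1#          ≈⟨ +-congʳ (+-assoc _ _ _) ⟨
      m · 1# + 1# - 1# - n · 1#            ≈⟨ +-assoc _ _ _ ⟩
      m · 1# + 1# + (- 1# - n · 1#)        ≈⟨ +-cong (+-comm _ _) (⁻¹-∙-comm 1# _) ⟩
      1# + m · 1# - (1# + n · 1#)          ≈⟨ +-cong (1+× m 1#) (-‿cong (1+× n 1#)) ⟨
      suc m · 1# - suc n · 1#              ∎

    -◃-homo : ∀ n → ⟦ Sign.- ◃ n ⟧ ≈ - (n · 1#)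
    -◃-homo zero    = sym -0#≈0#
    -◃-homo (suc n) = refl

    +◃-homo : ∀ n → ⟦ Sign.+ ◃ n ⟧ ≈ n · 1#
    +◃-homo zero    = refl
    +◃-homo (suc n) = refl

    +-homo : ∀ i j → ⟦ i ℤ.+ j ⟧ ≈ ⟦ i ⟧ + ⟦ j ⟧
    +-homo (+ m)    (+ n)    = ×-homo-+ 1# m n
    +-homo (+ m)    -[1+ n ] = ⊖-homo m (suc n)
    +-homo -[1+ m ] (+ n)    = trans (⊖-homo n (suc m)) (+-comm _ _)
    +-homo -[1+ m ] -[1+ n ] = begin
      - (suc (suc (m ℕ.+ n)) · 1#)         ≡⟨ ≡.cong (λ k → - (suc k · 1#)) (ℕ.+-suc m n) ⟨
      - ((suc m ℕ.+ suc n) · 1#)           ≈⟨ -‿cong (×-homo-+ 1# (suc m) (suc n)) ⟩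
      - (suc m · 1# + suc n · 1#)          ≈⟨ ⁻¹-∙-comm _ _ ⟨
      - (suc m · 1#) - suc n · 1#          ∎

    *-homo : ∀ i j → ⟦ i ℤ.* j ⟧ ≈ ⟦ i ⟧ * ⟦ j ⟧
    *-homo (+ m)    (+ n)    = trans (+◃-homo (m ℕ.* n)) (×1-homo-* m n)
    *-homo (+ m)    -[1+ n ] = begin
      ⟦ Sign.- ◃ m ℕ.* suc n ⟧             ≈⟨ -◃-homo (m ℕ.* suc n) ⟩
      - ((m ℕ.* suc n) · 1#)               ≈⟨ -‿cong (×1-homo-* m (suc n)) ⟩
      - (m · 1# * (suc n · 1#))            ≈⟨ -‿distribʳ-* _ _ ⟩
      m · 1# * - (suc n · 1#)              ∎
    *-homo -[1+ m ] (+ n)    = begin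
      ⟦ Sign.- ◃ suc m ℕ.* n ⟧             ≈⟨ -◃-homo (suc m ℕ.* n) ⟩
      - ((suc m ℕ.* n) · 1#)               ≈⟨ -‿cong (×1-homo-* (suc m) n) ⟩
      - (suc m · 1# * (n · 1#))            ≈⟨ -‿distribˡ-* _ _ ⟩
      - (suc m · 1#) * (n · 1#)            ∎
    *-homo -[1+ m ] -[1+ n ] = begin
      (suc m ℕ.* suc n) · 1#               ≈⟨ ×1-homo-* (suc m) (suc n) ⟩
      suc m · 1# * (suc n · 1#)            ≈⟨ -‿involutive _ ⟨
      - - (suc m · 1# * (suc n · 1#))      ≈⟨ -‿cong (-‿distribˡ-* _ _) ⟩
      - (- (suc m · 1#) * (suc n · 1#))    ≈⟨ -‿distribʳ-* _ _ ⟩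
      - (suc m · 1#) * - (suc n · 1#)      ∎

    -‿homo : ∀ i → ⟦ ℤ.- i ⟧ ≈ - ⟦ i ⟧
    -‿homo (+ zero)  = sym -0#≈0#
    -‿homo (+ suc n) = refl
    -‿homo -[1+ n ]  = sym (-‿involutive _)

    morphism : ℤ.+-*-rawRing -Raw-AlmostCommutative⟶ fromCommutativeRing R
    morphism = record
      { ⟦_⟧    = ⟦_⟧
      ; +-homo = +-homo
      ; *-homo = *-homo
      ; -‿homo = -‿homo
      ; 0-homo = refl
      ; 1-homo = refl
      }

  open RingSolver ℤ.+-*-rawRing (fromCommutativeRing R) morphism
    (λ i j → Maybe.map (λ eq → reflexive (≡.cong ⟦_⟧ eq)) (dec⇒maybe (i ℤ.≟ j))) public
    using (solve; _:=_; _:+_; _:*_; _:-_; :-_; con)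

-- Counting and indexing in lists

length-filter-¬ : ∀ {a p} {A : Set a} {P : Pred A p} (P? : Decidable P) xs →
                  length (filter P? xs) ℕ.+ length (filter (¬? ∘ P?) xs) ≡ length xs
length-filter-¬ P? []       = ≡.refl
length-filter-¬ P? (x ∷ xs) with does (P? x)
... | true  = ≡.cong suc (length-filter-¬ P? xs)
... | false = ≡.trans (ℕ.+-suc _ _) (≡.cong suc (length-filter-¬ P? xs))

lookup-antitone : ∀ {ns} → AllPairs _≥_ ns → ∀ {k l : Fin (length ns)} →
                  toℕ k ≤ toℕ l → lookup ns l ≤ lookup ns k
lookup-antitone (n≥ ∷ _) {zero}  {zero}  _         = ≤-refl
lookup-antitone (n≥ ∷ _) {zero}  {suc l} _         = All.lookup n≥ (∈-lookup l)
lookup-antitone (_ ∷ ns) {suc k} {suc l} (s≤s k≤l) = lookup-antitone ns k≤l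

lookup-injective : ∀ {a} {A : Set a} {xs : List A} → Unique xs →
                   ∀ k l → lookup xs k ≡ lookup xs l → k ≡ l
lookup-injective (_ ∷ _)   zero    zero    _  = ≡.refl
lookup-injective (x∉ ∷ _)  zero    (suc l) eq = contradiction eq (All.lookup x∉ (∈-lookup l))
lookup-injective (x∉ ∷ _)  (suc k) zero    eq =
    contradiction (≡.sym eq) (All.lookup x∉ (∈-lookup k))
lookup-injective (_ ∷ xs!) (suc k) (suc l) eq = ≡.cong suc (lookup-injective xs! k l eq)

-- The diagram and its ideals in coordinates

module Diagram (lam : Partition) where

  open Partition lam
  open Ferrers lam
  open FinitePoset 𝒫 using (size; _≼_)
  open OrderIdeals 𝒫

  height width : ℕ
  height = length parts
  width  = sumℕ parts

  -- Cells are 0-indexed from here on.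
  D : ℕ → ℕ → Set
  D i j = InDiagram (suc i , suc j)

  D? : ∀ i j → Dec (D i j)
  D? i j = inDiagram? (suc i , suc j)

  D-down : ∀ {i j k l} → i ≤ k → j ≤ l → D k l → D i j
  D-down {i} {j} i≤k j≤l (r , ≡.refl , _ , l<) = Fin.fromℕ< i< ,
      ≡.cong suc (≡.sym (Fin.toℕ-fromℕ< i<))
    , s≤s z≤n , ≤-trans (s≤s j≤l)
        (≤-trans l< (lookup-antitone (Linked⇒AllPairs (λ x≥y y≥z → ≤-trans y≥z x≥y) nonIncreasing)
            toℕ≤))
    where
    i< : i ℕ.< height
    i< = ≤-trans (s≤s i≤k) (Fin.toℕ<n r)
    toℕ≤ : toℕ (Fin.fromℕ< i<) ≤ toℕ r
    toℕ≤ = ≡.subst (_≤ toℕ r) (≡.sym (Fin.toℕ-fromℕ< i<)) i≤k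

  D-bounded : ∀ {i j} → D i j → i ℕ.< height × j ℕ.< width
  D-bounded {i} {j} d
    with ∈-cartesianProduct⁻ (applyUpTo suc height) (applyUpTo suc width)
           (proj₁ (∈-filter⁻ inDiagram? {xs = box} (Equivalence.from ∈-cells⇔InDiagram d)))
  ... | i∈ , j∈ with ∈-applyUpTo⁻ suc i∈ | ∈-applyUpTo⁻ suc j∈
  ... | _ , i< , ≡.refl | _ , j< , ≡.refl = i< , j<

  row col : Fin size → ℕ
  row p = pred (proj₁ (cell p))
  col p = pred (proj₂ (cell p))

  cell-in : ∀ p → InDiagram (cell p)
  cell-in p = Equivalence.to ∈-cells⇔InDiagram (∈-lookup p)

  suc-pred² : ∀ {x} → InDiagram x → x ≡ (suc (pred (proj₁ x)) , suc (pred (proj₂ x)))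
  suc-pred² (_ , ≡.refl , s≤s _ , _) = ≡.refl

  cell≡ : ∀ p → cell p ≡ (suc (row p) , suc (col p))
  cell≡ p = suc-pred² (cell-in p)

  D-cell : ∀ p → D (row p) (col p)
  D-cell p = ≡.subst InDiagram (cell≡ p) (cell-in p)

  position-injective : ∀ {p q} → row p ≡ row q → col p ≡ col q → p ≡ q
  position-injective {p} {q} r c = cell-injective p q
    (≡.trans (cell≡ p) (≡.trans (≡.cong₂ (λ i j → suc i , suc j) r c) (≡.sym (cell≡ q))))

  cellAt : ∀ {i j} → D i j → ∃ λ p → row p ≡ i × col p ≡ j
  cellAt d = Any.index d∈ , ≡.cong (pred ∘ proj₁) (≡.sym (Any.lookup-index d∈)) ,
      ≡.cong (pred ∘ proj₂) (≡.sym (Any.lookup-index d∈))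
    where d∈ = Equivalence.from ∈-cells⇔InDiagram d

  ≼⁺ : ∀ {p q} → row p ≤ row q → col p ≤ col q → p ≼ q
  ≼⁺ {p} {q} r c = ≡.subst₂ _⊑_ (≡.sym (cell≡ p)) (≡.sym (cell≡ q)) (s≤s r , s≤s c)

  ≼⁻ : ∀ {p q} → p ≼ q → row p ≤ row q × col p ≤ col q
  ≼⁻ (r , c) = ℕ.pred-mono-≤ r , ℕ.pred-mono-≤ c

  -- Membership by coordinates makes sense for every box of ℕ², so the neighbours of a cell can be
  -- mentioned before it is known whether they lie in λ.
  Mem : OrderIdeal → ℕ → ℕ → Set
  Mem I i j = ∃ λ p → row p ≡ i × col p ≡ j × p ∈ members I

  mem? : ∀ I i j → Dec (Mem I i j)
  mem? I i j = Fin.any? λ p → (row p ℕ.≟ i) ×-dec ((col p ℕ.≟ j) ×-dec (p ∈? members I))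

  mem⁺ : ∀ {I p} → p ∈ members I → Mem I (row p) (col p)
  mem⁺ p∈I = _ , ≡.refl , ≡.refl , p∈I

  mem⁻ : ∀ {I p} → Mem I (row p) (col p) → p ∈ members I
  mem⁻ {I} (q , r , c , q∈I) = ≡.subst (_∈ members I) (position-injective r c) q∈I

  mem⇒D : ∀ {I i j} → Mem I i j → D i j
  mem⇒D (p , ≡.refl , ≡.refl , _) = D-cell p

  mem-down : ∀ {I i j k l} → i ≤ k → j ≤ l → Mem I k l → Mem I i j
  mem-down {I} i≤k j≤l m@(q , ≡.refl , ≡.refl , q∈I) with cellAt (D-down i≤k j≤l (mem⇒D {I} m))
  ... | p , ≡.refl , ≡.refl = p , ≡.refl , ≡.refl , downClosed I p q (≼⁺ {p} {q} i≤k j≤l) q∈I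

  -- A predecessor missing at the edge counts as present, so that addability has one form for all
  -- cells.
  Above Left : (ℕ → ℕ → Set) → ℕ → ℕ → Set
  Above M zero    j = ⊤
  Above M (suc i) j = M i j
  Left M i zero    = ⊤
  Left M i (suc j) = M i j

  -- By down-closure, an element of `I` strictly beyond `p` would bring one of the two immediate
  -- successors of `p` into `I`.
  maximal⁺ : ∀ {I p} → Mem I (row p) (col p) → ¬ Mem I (suc (row p)) (col p) →
             ¬ Mem I (row p) (suc (col p)) → Maximal p I
  maximal⁺ {I} {p} p∈I down∉I right∉I = mem⁻ {I} p∈I , maximal
    where
    maximal : ∀ q → q ∈ members I → p ≼ q → p ≡ q
    maximal q q∈I p≼q with ≼⁻ {p} {q} p≼q
    ... | r , c with m≤n⇒m<n∨m≡n r | m≤n⇒m<n∨m≡n c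
    ... | inj₁ r< | _       = contradiction (mem-down {I} r< c (mem⁺ {I} q∈I)) down∉I
    ... | inj₂ _  | inj₁ c< = contradiction (mem-down {I} r c< (mem⁺ {I} q∈I)) right∉I
    ... | inj₂ r≡ | inj₂ c≡ = position-injective r≡ c≡

  maximal⁻ : ∀ {I p} → Maximal p I → Mem I (row p) (col p) ×
             ¬ Mem I (suc (row p)) (col p) × ¬ Mem I (row p) (suc (col p))
  maximal⁻ {I} {p} (p∈I , maximal) = mem⁺ {I} p∈I
    , (λ (q , r , c , q∈I) → ℕ.1+n≢n (≡.trans (≡.sym r) (≡.cong row (≡.sym (maximal q q∈I
        (≼⁺ {p} {q} (≤-trans (n≤1+n _) (ℕ.≤-reflexive (≡.sym r))) (ℕ.≤-reflexive (≡.sym c))))))))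
    , (λ (q , r , c , q∈I) → ℕ.1+n≢n (≡.trans (≡.sym c) (≡.cong col (≡.sym (maximal q q∈I
        (≼⁺ {p} {q} (ℕ.≤-reflexive (≡.sym r)) (≤-trans (n≤1+n _) (ℕ.≤-reflexive (≡.sym c)))))))))

  <⇒Above : ∀ {I i j k l} → i ℕ.< k → j ≤ l → Above (Mem I) k l → Mem I i j
  <⇒Above {I} (s≤s i≤k) j≤l = mem-down {I} i≤k j≤l

  <⇒Left : ∀ {I i j k l} → i ≤ k → j ℕ.< l → Left (Mem I) k l → Mem I i j
  <⇒Left {I} i≤k (s≤s j≤l) = mem-down {I} i≤k j≤l

  addable⁺ : ∀ {I p} → ¬ Mem I (row p) (col p) → Above (Mem I) (row p) (col p) →
             Left (Mem I) (row p) (col p) → Addable p I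
  addable⁺ {I} {p} p∉I above left = p∉I ∘ mem⁺ {I} , closed
    where
    closed : DownClosed (members I ∪ ⁅ p ⁆)
    closed q r q≼r r∈ with x∈p∪q⁻ (members I) ⁅ p ⁆ r∈
    ... | inj₁ r∈I = x∈p∪q⁺ (inj₁ (downClosed I q r q≼r r∈I))
    ... | inj₂ r∈p with x∈⁅y⁆⇒x≡y p r∈p
    ... | ≡.refl with ≼⁻ {q} {r} q≼r
    ... | r≤ , c≤ with m≤n⇒m<n∨m≡n r≤ | m≤n⇒m<n∨m≡n c≤
    ... | inj₁ r< | _       = x∈p∪q⁺ (inj₁ (mem⁻ {I} (<⇒Above {I} r< c≤ above)))
    ... | inj₂ _  | inj₁ c< = x∈p∪q⁺ (inj₁ (mem⁻ {I} (<⇒Left {I} r≤ c< left)))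
    ... | inj₂ r≡ | inj₂ c≡ = ≡.subst (_∈ members I ∪ ⁅ p ⁆) (≡.sym (position-injective r≡ c≡)) r∈

  addable⁻ : ∀ {I p} → Addable p I → ¬ Mem I (row p) (col p) ×
             Above (Mem I) (row p) (col p) × Left (Mem I) (row p) (col p)
  addable⁻ {I} {p} (p∉I , closed) = p∉I ∘ mem⁻ {I} , above (row p) ≡.refl , left (col p) ≡.refl
    where
    lower : ∀ {i j} → D i j → i ≤ row p → j ≤ col p → ¬ (i ≡ row p × j ≡ col p) → Mem I i j
    lower d i≤ j≤ ≢p with cellAt d
    ... | q , ≡.refl , ≡.refl with x∈p∪q⁻ (members I) ⁅ p ⁆
        (closed q p (≼⁺ {q} {p} i≤ j≤) (x∈p∪q⁺ (inj₂ (x∈⁅x⁆ p))))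
    ... | inj₁ q∈I = mem⁺ {I} q∈I
    ... | inj₂ q∈p with x∈⁅y⁆⇒x≡y p q∈p
    ... | ≡.refl = contradiction (≡.refl , ≡.refl) ≢p
    above : ∀ i → i ≡ row p → Above (Mem I) i (col p)
    above zero    _  = tt
    above (suc i) eq = lower (D-down (≤-trans (n≤1+n i) (ℕ.≤-reflexive eq)) ≤-refl (D-cell p))
      (≤-trans (n≤1+n i) (ℕ.≤-reflexive eq)) ≤-refl (λ (i≡ , _) → ℕ.1+n≢n (≡.trans eq (≡.sym i≡)))
    left : ∀ j → j ≡ col p → Left (Mem I) (row p) j
    left zero    _  = tt
    left (suc j) eq = lower (D-down ≤-refl (≤-trans (n≤1+n j) (ℕ.≤-reflexive eq)) (D-cell p))
      ≤-refl (≤-trans (n≤1+n j) (ℕ.≤-reflexive eq)) (λ (_ , j≡) → ℕ.1+n≢n (≡.trans eq (≡.sym j≡)))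

  -- Ideals are cut out of λ by down-closed sets of boxes that can be described without reference to
  -- λ.
  module _ {S : ℕ → ℕ → Set} (S? : ∀ i j → Dec (S i j))
           (S-down : ∀ {i j k l} → i ≤ k → j ≤ l → S k l → S i j) where

    private
      shape : Subset size
      shape = tabulate λ p → does (S? (row p) (col p))

      shape⁺ : ∀ {p} → S (row p) (col p) → p ∈ shape
      shape⁺ {p} s = lookup⇒[]= p shape
        (≡.trans (lookup∘tabulate _ p) (dec-true (S? _ _) s))

      shape⁻ : ∀ {p} → p ∈ shape → S (row p) (col p)
      shape⁻ {p} p∈ with S? (row p) (col p) | ≡.trans
          (≡.sym (lookup∘tabulate (λ p → does (S? (row p) (col p))) p)) ([]=⇒lookup p∈)
      ... | yes s | _  = s
      ... | no _  | ()

    restrict : OrderIdeal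
    restrict = ideal shape λ p q p≼q q∈ →
      shape⁺ (S-down (proj₁ (≼⁻ {p} {q} p≼q)) (proj₂ (≼⁻ {p} {q} p≼q)) (shape⁻ q∈))

    restrict⁺ : ∀ {i j} → D i j → S i j → Mem restrict i j
    restrict⁺ d s with cellAt d
    ... | p , ≡.refl , ≡.refl = p , ≡.refl , ≡.refl , shape⁺ s

    restrict⁻ : ∀ {i j} → Mem restrict i j → S i j
    restrict⁻ (p , ≡.refl , ≡.refl , p∈) = shape⁻ p∈

  -- Diagonals and the border cells other than corners

  -- One cell for each diagonal that carries a free value; this list indexes the parameters of both
  -- spaces.
  strip : List Cell
  strip = filter (¬? ∘ isCorner?) borderStrip

  length-strip : length borderStrip ∸ length corners ≡ length strip
  length-strip = ≡.trans
      (≡.cong (_∸ length corners) (≡.sym (length-filter-¬ isCorner? borderStrip)))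
    (ℕ.m+n∸m≡n (length corners) (length strip))

  srow scol : Fin (length strip) → ℕ
  srow k = pred (proj₁ (lookup strip k))
  scol k = pred (proj₂ (lookup strip k))

  strip-injective : ∀ {k l} → srow k ≡ srow l × scol k ≡ scol l → k ≡ l
  strip-injective {k} {l} (r , c) = lookup-injective strip-unique k l
    (≡.trans (strip≡ k) (≡.trans (≡.cong₂ (λ i j → suc i , suc j) r c) (≡.sym (strip≡ l))))
    where
    strip-unique : Unique strip
    strip-unique = Unique.filter⁺ (¬? ∘ isCorner?) (Unique.filter⁺ inBorder? cells-unique)
    strip≡ : ∀ k → lookup strip k ≡ (suc (srow k) , suc (scol k))
    strip≡ k = suc-pred² (proj₁ (proj₂ (∈-filter⁻ inBorder? {xs = cells}
      (proj₁ (∈-filter⁻ (¬? ∘ isCorner?) {xs = borderStrip} (∈-lookup k))))))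

  -- A border cell is a corner exactly when it is `Inner`: its two successors then belong to the
  -- border automatically, since (i + 2 , j + 1) or (i + 1 , j + 2) in λ would put (i + 1 , j + 1)
  -- there.
  Border Inner : ℕ → ℕ → Set
  Border i j = D i j × ¬ D (suc i) (suc j)
  Inner i j = D (suc i) j × D i (suc j)

  strip⁻ : ∀ k → Border (srow k) (scol k) × ¬ Inner (srow k) (scol k)
  strip⁻ k = strip-cell (suc-pred² (proj₁ border)) border (proj₂ k∈)
    where
    k∈ = ∈-filter⁻ (¬? ∘ isCorner?) {xs = borderStrip} (∈-lookup k)
    border = proj₂ (∈-filter⁻ inBorder? {xs = cells} (proj₁ k∈))
    strip-cell : ∀ {x i j} → x ≡ (suc i , suc j) → InBorder x → ¬ IsCorner x →
        Border i j × ¬ Inner i j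
    strip-cell ≡.refl (d , d∉) noncorner = (d , d∉) , λ (down , right) → noncorner
      ((d , d∉) , (down , λ d′ → d∉ (D-down (n≤1+n _) ≤-refl d′))
                , (right , λ d′ → d∉ (D-down ≤-refl (n≤1+n _) d′)))

  strip⁺ : ∀ {i j} → Border i j → ¬ Inner i j → ∃ λ k → srow k ≡ i × scol k ≡ j
  strip⁺ border@(d , _) outer = Any.index x∈ , ≡.cong (pred ∘ proj₁) (≡.sym (Any.lookup-index x∈))
                                             , ≡.cong (pred ∘ proj₂) (≡.sym (Any.lookup-index x∈))
    where
    x∈ = ∈-filter⁺ (¬? ∘ isCorner?)
           (∈-filter⁺ inBorder? (Equivalence.from ∈-cells⇔InDiagram d) border)
           (λ (_ , (down , _) , (right , _)) → outer (down , right))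

  -- The equation i - j = k - l, rearranged to avoid truncated subtraction.
  SameDiagonal : ℕ → ℕ → ℕ → ℕ → Set
  SameDiagonal i j k l = i ℕ.+ l ≡ k ℕ.+ j

  sameDiagonal? : ∀ i j k l → Dec (SameDiagonal i j k l)
  sameDiagonal? i j k l = i ℕ.+ l ℕ.≟ k ℕ.+ j

  diagonal-< : ∀ {i j k l} → SameDiagonal i j k l → i ℕ.< k → j ℕ.< l
  diagonal-< {i} {j} {k} {l} eq i<k =
    ℕ.≰⇒> λ l≤j → ℕ.<⇒≢ (ℕ.+-mono-<-≤ i<k l≤j) eq

  -- Of two distinct cells of λ on a diagonal, the earlier one has its diagonal successor weakly
  -- below the later one in the order, hence in λ, and so is not a border cell.
  border-diagonal : ∀ {i j k l} → Border i j → Border k l → SameDiagonal i j k l → i ≡ k × j ≡ l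
  border-diagonal {i} {j} {k} {l} (d , d∉) (d′ , d′∉) eq with <-cmp i k
  ... | tri< i<k _ _ = contradiction (D-down i<k (diagonal-< {i} {j} eq i<k) d′) d∉
  ... | tri≈ _ ≡.refl _ = ≡.refl , ≡.sym (ℕ.+-cancelˡ-≡ i l j eq)
  ... | tri> _ _ k<i = contradiction (D-down k<i (diagonal-< {k} {l} (≡.sym eq) k<i) d) d′∉

  -- The box (0 , j) is the least one on its diagonal, so the whole diagonal misses λ.
  strip-avoids-row : ∀ {j} → ¬ D 0 j → ∀ k → ¬ SameDiagonal (srow k) (scol k) 0 j
  strip-avoids-row {j} d∉ k eq =
    d∉ (D-down z≤n (≡.subst (j ≤_) eq (ℕ.m≤n+m j (srow k))) (proj₁ (proj₁ (strip⁻ k))))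

  strip-avoids-column : ∀ {i} → ¬ D i 0 → ∀ k → ¬ SameDiagonal (srow k) (scol k) i 0
  strip-avoids-column {i} d∉ k eq =
    d∉ (D-down (≡.subst (i ≤_) (≡.trans (≡.sym eq) (ℕ.+-identityʳ _)) (ℕ.m≤m+n i (scol k))) z≤n
               (proj₁ (proj₁ (strip⁻ k))))

  -- The border cell must be (i , j) itself: an earlier cell has its diagonal successor below (i , j
  -- + 1), and a later one would put (i + 1 , j + 1) in λ.
  diagonal-through-addable : ∀ {r c i j} → Border r c → SameDiagonal r c i j → ¬ D (suc i) (suc j) →
                             D i (suc j) → D (suc i) j → Inner r c
  diagonal-through-addable {r} {c} {i} {j} (d , d₁₁∉) eq d∉ above left with <-cmp r i
  ... | tri< r<i _ _  =
      contradiction (D-down r<i (≤-trans (diagonal-< {r} {c} eq r<i) (n≤1+n j)) above) d₁₁∉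
  ... | tri> _ _ i<r  = contradiction (D-down i<r (diagonal-< {i} {j} (≡.sym eq) i<r) d) d∉
  ... | tri≈ _ ≡.refl _ with ℕ.+-cancelˡ-≡ r j c eq
  ... | ≡.refl = left , above

  strip-avoids-addable : ∀ i j → ¬ D i j → Above D i j → Left D i j →
                         ∀ k → ¬ SameDiagonal (srow k) (scol k) i j
  strip-avoids-addable zero    j       d∉ above left = strip-avoids-row d∉
  strip-avoids-addable (suc i) zero    d∉ above left = strip-avoids-column d∉
  strip-avoids-addable (suc i) (suc j) d∉ above left k eq = proj₂ (strip⁻ k)
    (diagonal-through-addable (proj₁ (strip⁻ k))
      (ℕ.suc-injective (≡.trans (≡.sym (ℕ.+-suc (srow k) j)) eq)) d∉ above left)

-- Sums over ranges, boxes and lists; Kronecker deltas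

module FiniteSums {c ℓ} (R : CommutativeRing c ℓ) where

  open CommutativeRing R hiding (zero)
  open SemiringSum semiring using (sum; sum-cong-≋; sum-replicate-zero)
  open IntegerCoefficients R using (solve; _:=_; _:+_; _:*_)
  open SetoidReasoning setoid

  sum-zero : ∀ {n} {f : Vector Carrier n} → (∀ i → f i ≈ 0#) → sum f ≈ 0#
  sum-zero {n} f≈0 = trans (sum-cong-≋ f≈0) (sum-replicate-zero n)

  sum-single : ∀ {n} {f : Vector Carrier n} k → (∀ i → i ≢ k → f i ≈ 0#) → sum f ≈ f k
  sum-single zero f≈0 = trans (+-congˡ (sum-zero λ i → f≈0 (suc i) λ ())) (+-identityʳ _)
  sum-single (suc k) f≈0 =
    trans (+-cong (f≈0 zero λ ()) (sum-single k λ i i≢k → f≈0 (suc i) (i≢k ∘ Fin.suc-injective)))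
          (+-identityˡ _)

  Σ< : ℕ → (ℕ → Carrier) → Carrier
  Σ< zero    f = 0#
  Σ< (suc n) f = f 0 + Σ< n (f ∘ suc)

  □ : ℕ → ℕ → (ℕ → ℕ → Carrier) → Carrier
  □ m n g = Σ< m λ i → Σ< n (g i)

  Σ<-cong : ∀ n {f g} → (∀ i → f i ≈ g i) → Σ< n f ≈ Σ< n g
  Σ<-cong zero    f≈g = refl
  Σ<-cong (suc n) f≈g = +-cong (f≈g 0) (Σ<-cong n (f≈g ∘ suc))

  Σ<-zero : ∀ n {f} → (∀ i → f i ≈ 0#) → Σ< n f ≈ 0#
  Σ<-zero zero    f≈0 = refl
  Σ<-zero (suc n) f≈0 = trans (+-cong (f≈0 0) (Σ<-zero n (f≈0 ∘ suc))) (+-identityˡ 0#)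

  Σ<-+ : ∀ n f g → Σ< n (λ i → f i + g i) ≈ Σ< n f + Σ< n g
  Σ<-+ zero    f g = sym (+-identityˡ 0#)
  Σ<-+ (suc n) f g = trans (+-congˡ (Σ<-+ n (f ∘ suc) (g ∘ suc)))
    (solve 4 (λ a b c d → (a :+ b) :+ (c :+ d) := (a :+ c) :+ (b :+ d)) refl _ _ _ _)

  Σ<-*ʳ : ∀ n f x → Σ< n (λ i → f i * x) ≈ Σ< n f * x
  Σ<-*ʳ zero    f x = sym (zeroˡ x)
  Σ<-*ʳ (suc n) f x = trans (+-congˡ (Σ<-*ʳ n (f ∘ suc) x)) (sym (distribʳ x _ _))

  Σ<-last : ∀ n {f} → f n ≈ 0# → Σ< (suc n) f ≈ Σ< n f
  Σ<-last zero    fn≈0 = trans (+-identityʳ _) fn≈0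
  Σ<-last (suc n) fn≈0 = +-congˡ (Σ<-last n fn≈0)

  □-cong : ∀ m n {f g} → (∀ i j → f i j ≈ g i j) → □ m n f ≈ □ m n g
  □-cong m n f≈g = Σ<-cong m λ i → Σ<-cong n (f≈g i)

  □-zero : ∀ m n {f} → (∀ i j → f i j ≈ 0#) → □ m n f ≈ 0#
  □-zero m n f≈0 = Σ<-zero m λ i → Σ<-zero n (f≈0 i)

  □-+ : ∀ m n f g → □ m n (λ i j → f i j + g i j) ≈ □ m n f + □ m n g
  □-+ m n f g = trans (Σ<-cong m λ i → Σ<-+ n (f i) (g i)) (Σ<-+ m _ _)

  □-last : ∀ m n {f} → (∀ i → f i n ≈ 0#) → (∀ j → f m j ≈ 0#) →
           □ (suc m) (suc n) f ≈ □ m n f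
  □-last m n last-column last-row =
    trans (Σ<-last m (Σ<-zero (suc n) last-row)) (Σ<-cong m λ i → Σ<-last n (last-column i))

  δ : ℕ → ℕ → Carrier
  δ i j = if i ≡ᵇ j then 1# else 0#

  -- The value at the predecessor, with 0# in place of the missing f (-1).
  shift : (ℕ → Carrier) → ℕ → Carrier
  shift f zero    = 0#
  shift f (suc i) = f i

  Σ<-δ : ∀ {n k} (f : ℕ → Carrier) → k ℕ.< n → Σ< n (λ i → f i * δ i k) ≈ f k
  Σ<-δ {suc n} {zero}  f _           =
    trans (+-cong (*-identityʳ _) (Σ<-zero n λ i → zeroʳ (f (suc i)))) (+-identityʳ _)
  Σ<-δ {suc n} {suc k} f (ℕ.s≤s k<n) =
    trans (+-cong (zeroʳ _) (Σ<-δ (f ∘ suc) k<n)) (+-identityˡ _)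

  Σ<-δ-suc : ∀ {n k} (f : ℕ → Carrier) → k ℕ.< n → Σ< n (λ i → f i * δ (suc i) k) ≈ shift f k
  Σ<-δ-suc {n} {zero}  f _   = Σ<-zero n (λ i → zeroʳ (f i))
  Σ<-δ-suc {n} {suc k} f k<n = Σ<-δ f (ℕ.<⇒≤ k<n)

  □-factor : ∀ m n (f : ℕ → ℕ → Carrier) (x y : ℕ → Carrier) →
             □ m n (λ i j → f i j * (x i * y j)) ≈ Σ< m (λ i → Σ< n (λ j → f i j * y j) * x i)
  □-factor m n f x y = Σ<-cong m λ i → begin
    Σ< n (λ j → f i j * (x i * y j))
        ≈⟨ Σ<-cong n (λ j → solve 3 (λ a b c → a :* (b :* c) := a :* c :* b) refl (f i j) (x i)
            (y j)) ⟩
    Σ< n (λ j → f i j * y j * x i)     ≈⟨ Σ<-*ʳ n (λ j → f i j * y j) (x i) ⟩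
    Σ< n (λ j → f i j * y j) * x i     ∎

  module _ {m n k l} (f : ℕ → ℕ → Carrier) (k<m : k ℕ.< m) (l<n : l ℕ.< n) where

    □-δ : □ m n (λ i j → f i j * (δ i k * δ j l)) ≈ f k l
    □-δ = trans (□-factor m n f _ _)
      (trans (Σ<-cong m λ i → *-congʳ (Σ<-δ (f i) l<n)) (Σ<-δ (λ i → f i l) k<m))

    □-δ-sucˡ : □ m n (λ i j → f i j * (δ (suc i) k * δ j l)) ≈ shift (λ i → f i l) k
    □-δ-sucˡ = trans (□-factor m n f _ _)
      (trans (Σ<-cong m λ i → *-congʳ (Σ<-δ (f i) l<n)) (Σ<-δ-suc (λ i → f i l) k<m))

    □-δ-sucʳ : □ m n (λ i j → f i j * (δ i k * δ (suc j) l)) ≈ shift (f k) l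
    □-δ-sucʳ = trans (□-factor m n f _ _)
      (trans (Σ<-cong m λ i → *-congʳ (Σ<-δ-suc (f i) l<n)) (Σ<-δ (λ i → shift (f i) l) k<m))

  ∑ˡ : ∀ {a} {A : Set a} → List A → (A → Carrier) → Carrier
  ∑ˡ []       f = 0#
  ∑ˡ (x ∷ xs) f = f x + ∑ˡ xs f

  sum-lookup : ∀ {a} {A : Set a} (xs : List A) f → sum (λ k → f (lookup xs k)) ≈ ∑ˡ xs f
  sum-lookup []       f = refl
  sum-lookup (x ∷ xs) f = +-congˡ (sum-lookup xs f)

  ∑ˡ-++ : ∀ {a} {A : Set a} (xs : List A) {ys f} → ∑ˡ (xs ++ ys) f ≈ ∑ˡ xs f + ∑ˡ ys f
  ∑ˡ-++ []       = sym (+-identityˡ _)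
  ∑ˡ-++ (x ∷ xs) = trans (+-congˡ (∑ˡ-++ xs)) (sym (+-assoc _ _ _))

  ∑ˡ-map : ∀ {a b} {A : Set a} {B : Set b} (h : A → B) xs {f} →
           ∑ˡ (List.map h xs) f ≈ ∑ˡ xs (f ∘ h)
  ∑ˡ-map h []       = refl
  ∑ˡ-map h (x ∷ xs) = +-congˡ (∑ˡ-map h xs)

  ∑ˡ-filter : ∀ {a p} {A : Set a} {P : Pred A p} (P? : Decidable P) xs {f} →
              ∑ˡ (filter P? xs) f ≈ ∑ˡ xs (λ x → if does (P? x) then f x else 0#)
  ∑ˡ-filter P? []       = refl
  ∑ˡ-filter P? (x ∷ xs) with does (P? x)
  ... | true  = +-congˡ (∑ˡ-filter P? xs)
  ... | false = trans (∑ˡ-filter P? xs) (sym (+-identityˡ _))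

  ∑ˡ-applyUpTo : ∀ {a} {A : Set a} (h : ℕ → A) n {f} → ∑ˡ (applyUpTo h n) f ≈ Σ< n (f ∘ h)
  ∑ˡ-applyUpTo h zero    = refl
  ∑ˡ-applyUpTo h (suc n) = +-congˡ (∑ˡ-applyUpTo (h ∘ suc) n)

  ∑ˡ-cartesianProduct : ∀ {a b} {A : Set a} {B : Set b} (xs : List A) (ys : List B) {f} →
                        ∑ˡ (cartesianProduct xs ys) f ≈ ∑ˡ xs (λ x → ∑ˡ ys (λ y → f (x , y)))
  ∑ˡ-cartesianProduct []       ys = refl
  ∑ˡ-cartesianProduct (x ∷ xs) ys =
    trans (∑ˡ-++ (List.map (x ,_) ys))
          (+-cong (∑ˡ-map (x ,_) ys) (∑ˡ-cartesianProduct xs ys))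

-- Linear forms in a vector of parameters

module LinearForms {c ℓ} (R : CommutativeRing c ℓ) where

  open CommutativeRing R hiding (zero)
  open SemiringSum semiring using (sum; sum-cong-≋; ∑-distrib-+; *-distribʳ-sum)
  open FiniteSums R using (sum-zero)
  open IntegerCoefficients R using (solve; _:=_; _:*_; :-_; con)

  module _ {d : ℕ} where

    -- Linearity is given by explicit coefficients because these become the values of the basis
    -- vectors in `hasDimension`.
    IsLinear : (Vector Carrier d → Carrier) → Set (c ⊔ ℓ)
    IsLinear φ = Σ[ w ∈ Vector Carrier d ] (∀ t → φ t ≈ sum λ k → t k * w k)

    linear-0 : IsLinear λ _ → 0#
    linear-0 = (λ _ → 0#) , λ t → sym (sum-zero λ k → zeroʳ (t k))

    linear-+ : ∀ {φ ψ} → IsLinear φ → IsLinear ψ → IsLinear λ t → φ t + ψ t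
    linear-+ (v , φ≈) (w , ψ≈) = (λ k → v k + w k) , λ t → sym
      (trans (sum-cong-≋ λ k → distribˡ (t k) (v k) (w k))
      (trans (∑-distrib-+ (λ k → t k * v k) (λ k → t k * w k))
             (+-cong (sym (φ≈ t)) (sym (ψ≈ t)))))

    linear-* : ∀ {φ} → IsLinear φ → ∀ x → IsLinear λ t → φ t * x
    linear-* (w , φ≈) x = (λ k → w k * x) , λ t →
      trans (*-congʳ (φ≈ t))
      (trans (*-distribʳ-sum x (λ k → t k * w k)) (sum-cong-≋ λ k → *-assoc (t k) (w k) x))

    linear-neg : ∀ {φ} → IsLinear φ → IsLinear λ t → - φ t
    linear-neg φ-linear with linear-* φ-linear (- 1#)
    ... | w , φ≈ = w , λ t →
      trans (solve 1 (λ x → :- x := x :* (:- con (+ 1))) refl _) (φ≈ t)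

    linear-∑ : ∀ {n} {φ : Fin n → Vector Carrier d → Carrier} → (∀ i → IsLinear (φ i)) →
               IsLinear λ t → sum λ i → φ i t
    linear-∑ {zero}  lin = linear-0
    linear-∑ {suc n} lin = linear-+ (lin zero) (linear-∑ (lin ∘ suc))

    linear-if : ∀ b {φ ψ} → IsLinear φ → IsLinear ψ → IsLinear λ t → if b then φ t else ψ t
    linear-if true  φ-linear ψ-linear = φ-linear
    linear-if false φ-linear ψ-linear = ψ-linear

-- Characteristic zero, and dimension from a parametrization

module RingIdentities {c ℓ} (R : CommutativeRing c ℓ) where

  open CommutativeRing R hiding (zero)
  open SemiringMult semiring using (×-assoc-*; ×-congʳ) renaming (_×_ to _·_)
  open IntegerCoefficients R using (solve; _:=_; _:*_; _:-_; :-_; con)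
  open SetoidReasoning setoid

  1*[1-0]≈1 : 1# * (1# - 0#) ≈ 1#
  1*[1-0]≈1 = solve 0 (con (+ 1) :* (con (+ 1) :- con (+ 0)) := con (+ 1)) refl

  -1*-1≈1 : - 1# * - 1# ≈ 1#
  -1*-1≈1 = solve 0 (:- con (+ 1) :* :- con (+ 1) := con (+ 1)) refl

  -- The factor has the form `0# - n · 1#` because apartness of `0#` and `n · 1#` is what yields an
  -- inverse, namely one of their difference.
  invertible⇒torsionFree : ∀ n {y x} → y * (0# - n · 1#) ≈ 1# → n · x ≈ 0# → x ≈ 0#
  invertible⇒torsionFree n {y} {x} inv nx≈0 = begin
    x                              ≈⟨ *-identityˡ x ⟨
    1# * x                         ≈⟨ *-congʳ inv ⟨
    y * (0# - n · 1#) * x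
        ≈⟨ solve 3 (λ a b x → a :* (con (+ 0) :- b) :* x := :- (a :* (b :* x))) refl y (n · 1#) x ⟩
    - (y * (n · 1# * x))           ≈⟨ -‿cong (*-congˡ (×-assoc-* n 1# x)) ⟩
    - (y * (n · (1# * x)))         ≈⟨ -‿cong (*-congˡ (×-congʳ n (*-identityˡ x))) ⟩
    - (y * (n · x))                ≈⟨ -‿cong (*-congˡ nx≈0) ⟩
    - (y * 0#)                     ≈⟨ solve 1 (λ a → :- (a :* con (+ 0)) := con (+ 0)) refl y ⟩
    0#                             ∎

module RealFieldProperties {c ℓ₁ ℓ₂ ℓ₃} (ℝ : RealField c ℓ₁ ℓ₂ ℓ₃) where

  open RealField ℝ hiding (zero)
  open RingIdentities commutativeRing
  open IsStrictPartialOrder isStrictPartialOrder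
    using (irrefl; <-respʳ-≈; <-respˡ-≈) renaming (trans to <-trans)

  -- Otherwise 1 < 0, so 0 < -1 and hence 0 < (-1)(-1) = 1, a contradiction.
  0<1 : 0# < 1#
  0<1 with #⇒<⊎> (invertible⇒# {1#} {0#} (1# , 1*[1-0]≈1 , trans (*-comm _ _) 1*[1-0]≈1))
  ... | inj₂ 0<1 = 0<1
  ... | inj₁ 1<0 = contradiction (<-trans 0<1′ 1<0) (irrefl refl)
    where
    0<-1 : 0# < - 1#
    0<-1 = <-respˡ-≈ (-‿inverseʳ 1#) (<-respʳ-≈ (+-identityˡ _) (+-monoˡ-< (- 1#) 1<0))
    0<1′ : 0# < 1#
    0<1′ = <-respʳ-≈ -1*-1≈1 (*-pos 0<-1 0<-1)

  0<1+n : ∀ n → 0# < suc n · 1#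
  0<1+n zero    = <-respʳ-≈ (sym (+-identityʳ 1#)) 0<1
  0<1+n (suc n) = <-trans (0<1+n n) (<-respˡ-≈ (+-identityˡ _) (+-monoˡ-< (suc n · 1#) 0<1))

  -- Justifies the divisions in the independence proof, by 2 and by the length of an arithmetic
  -- progression.
  torsionFree : ∀ n {x} → suc n · x ≈ 0# → x ≈ 0#
  torsionFree n nx≈0 with #⇒invertible (<⇒# (0<1+n n))
  ... | y , inv , _ = invertible⇒torsionFree (suc n) inv nx≈0

  module _ {X : Set} where

    open LinearForms commutativeRing
    open LinearAlgebra ℝ {X}

    -- The images of the unit vectors under an injective linear parametrization form a basis; their
    -- values at `x` are the coefficients of the form `Φ t x`.
    hasDimension : ∀ {ℓ} {W : Pred (X → Carrier) ℓ} {d} (Φ : Vector Carrier d → X → Carrier) →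
                   (∀ x → IsLinear λ t → Φ t x) →
                   (∀ t → (∀ x → Φ t x ≈ 0#) → ∀ k → t k ≈ 0#) →
                   (∀ {f} → W f → ∃ λ t → ∀ x → f x ≈ Φ t x) →
                   (∀ t {f} → (∀ x → f x ≈ Φ t x) → W f) →
                   HasDimension W d
    hasDimension Φ linear injective onto into = record
      { basis       = λ k x → proj₁ (linear x) k
      ; independent = λ t comb≈0 → injective t λ x → trans (proj₂ (linear x) t) (comb≈0 x)
      ; spans       = (λ Wf → proj₁ (onto Wf) , λ x →
          trans (proj₂ (onto Wf) x) (proj₂ (linear x) _))
                    , λ (t , f≈) → into t λ x → trans (f≈ x) (sym (proj₂ (linear x) t))
      }

-- Toggles expressed by indicators of cells

module ToggleSums {c ℓ} (R : CommutativeRing c ℓ) (lam : Partition) where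

  open CommutativeRing R hiding (zero)
  open SemiringSum semiring using (sum; sum-cong-≋)
  open IntegerCoefficients R using (solve; _:=_; _:+_; _:*_; _:-_; :-_; con)
  open FiniteSums R
  open SetoidReasoning setoid
  open Diagram lam
  open Ferrers lam using (cells; cell; box; inDiagram?; 𝒫)
  open FinitePoset 𝒫 using (size)
  open OrderIdeals 𝒫

  χ : ∀ {A : Set} → Dec A → Carrier
  χ A? = if does A? then 1# else 0#

  if-true : ∀ {A : Set} (a? : Dec A) {x y} → A → (if does a? then x else y) ≈ x
  if-true (yes _) _ = refl
  if-true (no ¬a) a = contradiction a ¬a

  if-false : ∀ {A : Set} (a? : Dec A) {x y} → ¬ A → (if does a? then x else y) ≈ y
  if-false (yes a) ¬a = contradiction a ¬a
  if-false (no _)  _  = refl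

  if-cong : ∀ b {x x′ y y′} → x ≈ x′ → y ≈ y′ → (if b then x else y) ≈ (if b then x′ else y′)
  if-cong true  x≈x′ y≈y′ = x≈x′
  if-cong false x≈x′ y≈y′ = y≈y′

  χ-true : ∀ {A : Set} (a? : Dec A) → A → χ a? ≈ 1#
  χ-true a? = if-true a?

  χ-false : ∀ {A : Set} (a? : Dec A) → ¬ A → χ a? ≈ 0#
  χ-false a? = if-false a?

  χ-cong : ∀ {A B : Set} (a? : Dec A) (b? : Dec B) → (A → B) → (B → A) → χ a? ≈ χ b?
  χ-cong (yes a) b? f g = sym (χ-true b? (f a))
  χ-cong (no ¬a) b? f g = sym (χ-false b? (¬a ∘ g))

  -- The maximum of two values in {0, 1}, as a polynomial that the ring solver can handle.
  _∨_ : Carrier → Carrier → Carrier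
  x ∨ y = x + y - x * y

  -- Over the ring underlying ℝ these agree by definition with the functions in `Toggleability`.
  𝒯⁻ 𝒯⁺ 𝒯 : Fin size → OrderIdeal → Carrier
  𝒯⁻ p I = χ (maximal? p I)
  𝒯⁺ p I = χ (addable? p I)
  𝒯  p I = 𝒯⁺ p I - 𝒯⁻ p I

  above? : ∀ I i j → Dec (Above (Mem I) i j)
  above? I zero    j = yes tt
  above? I (suc i) j = mem? I i j

  left? : ∀ I i j → Dec (Left (Mem I) i j)
  left? I i zero    = yes tt
  left? I i (suc j) = mem? I i j

  -- o is the indicator of a cell, w that of its predecessors both being in the
  -- ideal, and u that of at least one of its successors being in the ideal.
  module _ (I : OrderIdeal) where

    o w u : ℕ → ℕ → Carrier
    o i j = χ (mem? I i j)
    w i j = χ (above? I i j) * χ (left? I i j)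
    u i j = o (suc i) j ∨ o i (suc j)

    o-out : ∀ {i j} → ¬ D i j → o i j ≈ 0#
    o-out d∉ = χ-false (mem? I _ _) (d∉ ∘ mem⇒D {I})

    u-out : ∀ {i j} → ¬ D i j → u i j ≈ 0#
    u-out d∉ = trans (+-cong (+-cong o₁₀ o₀₁) (-‿cong (*-cong o₁₀ o₀₁)))
      (solve 0 (con (+ 0) :+ con (+ 0) :- con (+ 0) :* con (+ 0) := con (+ 0)) refl)
      where
      o₁₀ = o-out (d∉ ∘ D-down (n≤1+n _) ≤-refl)
      o₀₁ = o-out (d∉ ∘ D-down ≤-refl (n≤1+n _))

    𝟏≈o : ∀ p → χ (p ∈? members I) ≈ o (row p) (col p)
    𝟏≈o p = χ-cong (p ∈? members I) (mem? I _ _) (mem⁺ {I}) (mem⁻ {I})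

    private
      χ-maximal : ∀ {A B C X : Set} (a? : Dec A) (b? : Dec B) (c? : Dec C) (x? : Dec X) →
                  (B → A) → (C → A) → (A → ¬ B → ¬ C → X) → (X → A × ¬ B × ¬ C) →
                  χ x? ≈ χ a? - (χ b? ∨ χ c?)
      χ-maximal (yes a) (no ¬b) (no ¬c) x? b⇒a c⇒a x⁺ x⁻ = trans (χ-true x? (x⁺ a ¬b ¬c))
        (solve 0 (con (+ 1) := con (+ 1) :- (con (+ 0) :+ con (+ 0) :- con (+ 0) :* con (+ 0)))
            refl)
      χ-maximal (yes a) (no ¬b) (yes c) x? b⇒a c⇒a x⁺ x⁻ =
          trans (χ-false x? λ x → proj₂ (proj₂ (x⁻ x)) c)
        (solve 0 (con (+ 0) := con (+ 1) :- (con (+ 0) :+ con (+ 1) :- con (+ 0) :* con (+ 1)))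
            refl)
      χ-maximal (yes a) (yes b) (no ¬c) x? b⇒a c⇒a x⁺ x⁻ =
          trans (χ-false x? λ x → proj₁ (proj₂ (x⁻ x)) b)
        (solve 0 (con (+ 0) := con (+ 1) :- (con (+ 1) :+ con (+ 0) :- con (+ 1) :* con (+ 0)))
            refl)
      χ-maximal (yes a) (yes b) (yes c) x? b⇒a c⇒a x⁺ x⁻ =
          trans (χ-false x? λ x → proj₁ (proj₂ (x⁻ x)) b)
        (solve 0 (con (+ 0) := con (+ 1) :- (con (+ 1) :+ con (+ 1) :- con (+ 1) :* con (+ 1)))
            refl)
      χ-maximal (no ¬a) (no ¬b) (no ¬c) x? b⇒a c⇒a x⁺ x⁻ =
          trans (χ-false x? λ x → ¬a (proj₁ (x⁻ x)))
        (solve 0 (con (+ 0) := con (+ 0) :- (con (+ 0) :+ con (+ 0) :- con (+ 0) :* con (+ 0)))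
            refl)
      χ-maximal (no ¬a) (yes b) c?      x? b⇒a c⇒a x⁺ x⁻ = contradiction (b⇒a b) ¬a
      χ-maximal (no ¬a) (no ¬b) (yes c) x? b⇒a c⇒a x⁺ x⁻ = contradiction (c⇒a c) ¬a

      χ-addable : ∀ {A B C X : Set} (a? : Dec A) (b? : Dec B) (c? : Dec C) (x? : Dec X) →
                  (A → B) → (A → C) → (¬ A → B → C → X) → (X → ¬ A × B × C) →
                  χ x? ≈ χ b? * χ c? - χ a?
      χ-addable (no ¬a) (yes b) (yes c) x? a⇒b a⇒c x⁺ x⁻ = trans (χ-true x? (x⁺ ¬a b c))
        (solve 0 (con (+ 1) := con (+ 1) :* con (+ 1) :- con (+ 0)) refl)
      χ-addable (no ¬a) (yes b) (no ¬c) x? a⇒b a⇒c x⁺ x⁻ =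
          trans (χ-false x? λ x → ¬c (proj₂ (proj₂ (x⁻ x))))
        (solve 0 (con (+ 0) := con (+ 1) :* con (+ 0) :- con (+ 0)) refl)
      χ-addable (no ¬a) (no ¬b) c?      x? a⇒b a⇒c x⁺ x⁻ =
          trans (χ-false x? λ x → ¬b (proj₁ (proj₂ (x⁻ x))))
        (solve 1 (λ y → con (+ 0) := con (+ 0) :* y :- con (+ 0)) refl _)
      χ-addable (yes a) (yes b) (yes c) x? a⇒b a⇒c x⁺ x⁻ = trans (χ-false x? λ x → proj₁ (x⁻ x) a)
        (solve 0 (con (+ 0) := con (+ 1) :* con (+ 1) :- con (+ 1)) refl)
      χ-addable (yes a) (no ¬b) c?      x? a⇒b a⇒c x⁺ x⁻ = contradiction (a⇒b a) ¬b
      χ-addable (yes a) (yes b) (no ¬c) x? a⇒b a⇒c x⁺ x⁻ = contradiction (a⇒c a) ¬c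

    𝒯⁻≈ : ∀ p → 𝒯⁻ p I ≈ o (row p) (col p) - u (row p) (col p)
    𝒯⁻≈ p = χ-maximal (mem? I _ _) (mem? I _ _) (mem? I _ _) (maximal? p I)
      (mem-down {I} (n≤1+n _) ≤-refl) (mem-down {I} ≤-refl (n≤1+n _)) (maximal⁺ {I}) (maximal⁻ {I})

    mem⇒Above : ∀ i {j} → Mem I i j → Above (Mem I) i j
    mem⇒Above zero    _ = tt
    mem⇒Above (suc i) m = mem-down {I} (n≤1+n i) ≤-refl m

    mem⇒Left : ∀ {i} j → Mem I i j → Left (Mem I) i j
    mem⇒Left zero    _ = tt
    mem⇒Left (suc j) m = mem-down {I} ≤-refl (n≤1+n j) m

    𝒯⁺≈ : ∀ p → 𝒯⁺ p I ≈ w (row p) (col p) - o (row p) (col p)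
    𝒯⁺≈ p = χ-addable (mem? I _ _) (above? I (row p) (col p)) (left? I (row p) (col p))
        (addable? p I)
      (mem⇒Above (row p)) (mem⇒Left (col p)) (addable⁺ {I}) (addable⁻ {I})

  -- Summation of toggles by parts

  private
    guard : (ℕ → ℕ → Carrier) → ℕ → ℕ → Carrier
    guard f i j = if does (D? i j) then f i j else 0#

  sum-cells : ∀ f → sum (λ p → f (row p) (col p)) ≈ □ height width (guard f)
  sum-cells f = begin
    sum (λ p → f (row p) (col p))      ≈⟨ sum-lookup cells (λ (i , j) → f (pred i) (pred j)) ⟩
    ∑ˡ cells _                          ≈⟨ ∑ˡ-filter inDiagram? box ⟩
    ∑ˡ box _
        ≈⟨ ∑ˡ-cartesianProduct (applyUpTo suc height) (applyUpTo suc width) ⟩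
    ∑ˡ (applyUpTo suc height) (λ i → ∑ˡ (applyUpTo suc width) _)
      ≈⟨ ∑ˡ-applyUpTo suc height ⟩
    Σ< height (λ i → ∑ˡ (applyUpTo suc width) _)
      ≈⟨ Σ<-cong height (λ i → ∑ˡ-applyUpTo suc width) ⟩
    □ height width (guard f)            ∎

  sum-cells-supported : ∀ {f g} → (∀ i j → D i j → f i j ≈ g i j) → (∀ i j → ¬ D i j → g i j ≈ 0#) →
                        sum (λ p → f (row p) (col p)) ≈ □ height width g
  sum-cells-supported {f} {g} f≈g g-out = trans (sum-cells f) (□-cong height width guard≈)
    where
    guard≈ : ∀ i j → guard f i j ≈ g i j
    guard≈ i j with D? i j
    ... | yes d = f≈g i j d
    ... | no d∉ = sym (g-out i j d∉)

  beyond-height : ∀ {j} → ¬ D height j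
  beyond-height d = ℕ.<-irrefl ≡.refl (proj₁ (D-bounded d))

  beyond-width : ∀ {i} → ¬ D i width
  beyond-width d = ℕ.<-irrefl ≡.refl (proj₂ (D-bounded d))

  -- Outside λ, `w` can be nonzero only at a box that can be added to λ; the condition thus makes
  -- `b i j * w I i j` vanish everywhere outside λ.
  AddableZero : (ℕ → ℕ → Carrier) → Set ℓ
  AddableZero b = ∀ i j → ¬ D i j → Above D i j → Left D i j → b i j ≈ 0#

  -- Summation by parts: b (i , j) meets the indicator of (i - 1 , j), of
  -- (i , j - 1), and, through the product in w, u (i - 1 , j - 1).
  module _ (b : ℕ → ℕ → Carrier) (I : OrderIdeal) where

    private
      m = height
      n = width
      x = o I
      X Y V : ℕ → ℕ → Carrier
      X i j = b (suc i) j * x i j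
      Y i j = b i (suc j) * x i j
      V i j = - b (suc i) (suc j) * u I i j

    □-w : □ (suc m) (suc n) (λ i j → b i j * w I i j) ≈
          b 0 0 + □ m n (λ i j → (X i j + Y i j) + V i j)
    □-w = begin
      (b 0 0 * (1# * 1#) + Σ< n (λ j → b 0 (suc j) * (1# * x 0 j)))
        + Σ< m (λ i → b (suc i) 0 * (x i 0 * 1#)
                      + Σ< n (λ j → b (suc i) (suc j) * (x i (suc j) * x (suc i) j)))
          ≈⟨ +-cong (+-cong (solve 1 (λ a → a :* (con (+ 1) :* con (+ 1)) := a) refl _)
                            (Σ<-cong n λ j → *-congˡ (*-identityˡ _)))
                    (Σ<-cong m split) ⟩
      (b 0 0 + Σ< n (Y 0)) + Σ< m (λ i → Σ< (suc n) (X i) + (Σ< n (Y (suc i)) + Σ< n (V i)))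
          ≈⟨ +-congˡ (trans (Σ<-+ m _ _) (+-congˡ (Σ<-+ m _ _))) ⟩
      (b 0 0 + Σ< n (Y 0)) + (□ m (suc n) X + (□ m n (λ i → Y (suc i)) + □ m n V))
          ≈⟨ solve 5 (λ a b c d e → (a :+ b) :+ (c :+ (d :+ e)) := a :+ ((c :+ (b :+ d)) :+ e))
              refl _ _ _ _ _ ⟩
      b 0 0 + ((□ m (suc n) X + □ (suc m) n Y) + □ m n V)
          ≈⟨ +-congˡ (+-congʳ (+-cong
               (Σ<-cong m λ i → Σ<-last n (trans (*-congˡ (o-out I beyond-width)) (zeroʳ _)))
               (Σ<-last m (Σ<-zero n λ j → trans (*-congˡ (o-out I beyond-height)) (zeroʳ _))))) ⟩
      b 0 0 + ((□ m n X + □ m n Y) + □ m n V)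
          ≈⟨ +-congˡ (trans (□-+ m n _ _) (+-congʳ (□-+ m n X Y))) ⟨
      b 0 0 + □ m n (λ i j → (X i j + Y i j) + V i j) ∎
      where
      product : ∀ i j → b (suc i) (suc j) * (x i (suc j) * x (suc i) j) ≈
                        X i (suc j) + (Y (suc i) j + V i j)
      product i j = solve 3
          (λ b p q → b :* (p :* q) := b :* p :+ (b :* q :+ (:- b) :* (q :+ p :- q :* p))) refl _ _ _
      split : ∀ i → b (suc i) 0 * (x i 0 * 1#)
                    + Σ< n (λ j → b (suc i) (suc j) * (x i (suc j) * x (suc i) j)) ≈
                    Σ< (suc n) (X i) + (Σ< n (Y (suc i)) + Σ< n (V i))
      split i = trans
        (+-cong (*-congˡ (*-identityʳ _))
                (trans (Σ<-cong n (product i)) (trans (Σ<-+ n _ _) (+-congˡ (Σ<-+ n _ _)))))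
        (sym (+-assoc _ _ _))

    toggle-sum : AddableZero b →
      sum (λ p → b (row p) (col p) * 𝒯 p I) ≈
      b 0 0 + □ m n (λ i j → (b (suc i) j + b i (suc j) - b i j - b i j) * x i j
                             + (b i j - b (suc i) (suc j)) * u I i j)
    toggle-sum b-zero = begin
      sum (λ p → b (row p) (col p) * 𝒯 p I)
        ≈⟨ sum-cong-≋ (λ p → *-congˡ (+-cong (𝒯⁺≈ I p) (-‿cong (𝒯⁻≈ I p)))) ⟩
      sum (λ p → f (row p) (col p))
        ≈⟨ sum-cells f ⟩
      □ m n (guard f)
        -- The extra row and column contain no cells of λ; with them, shifting the indices of `b` by
        -- one leaves sums over the original box.
        ≈⟨ □-last m n (λ i → guard-out beyond-width) (λ j → guard-out beyond-height) ⟨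
      □ (suc m) (suc n) (guard f)
        ≈⟨ □-cong (suc m) (suc n) guard≈ ⟩
      □ (suc m) (suc n) (λ i j → b i j * w I i j + g i j)
        ≈⟨ □-+ (suc m) (suc n) (λ i j → b i j * w I i j) g ⟩
      □ (suc m) (suc n) (λ i j → b i j * w I i j) + □ (suc m) (suc n) g
        ≈⟨ +-cong □-w (□-last m n (λ i → g-out beyond-width) (λ j → g-out beyond-height)) ⟩
      (b 0 0 + □ m n (λ i j → (X i j + Y i j) + V i j)) + □ m n g
        ≈⟨ trans (+-assoc _ _ _) (+-congˡ (sym (□-+ m n _ _))) ⟩
      b 0 0 + □ m n (λ i j → ((X i j + Y i j) + V i j) + g i j)
        ≈⟨ +-congˡ (□-cong m n λ i j → solve 6 (λ a₁₀ a₀₁ a₁₁ a o u →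
             a₁₀ :* o :+ a₀₁ :* o :+ (:- a₁₁) :* u :+ (a :* u :- a :* o :- a :* o)
             := (a₁₀ :+ a₀₁ :- a :- a) :* o :+ (a :- a₁₁) :* u) refl
             (b (suc i) j) (b i (suc j)) (b (suc i) (suc j)) (b i j) (x i j) (u I i j)) ⟩
      b 0 0 + □ m n (λ i j → (b (suc i) j + b i (suc j) - b i j - b i j) * x i j
                             + (b i j - b (suc i) (suc j)) * u I i j) ∎
      where
      f g : ℕ → ℕ → Carrier
      f i j = b i j * ((w I i j - x i j) - (x i j - u I i j))
      g i j = b i j * u I i j - b i j * x i j - b i j * x i j

      guard-out : ∀ {i j} → ¬ D i j → guard f i j ≈ 0#
      guard-out {i} {j} d∉ with D? i j
      ... | yes d = contradiction d d∉
      ... | no _  = refl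

      g-out : ∀ {i j} → ¬ D i j → g i j ≈ 0#
      g-out d∉ = trans (+-cong (+-cong (*-congˡ (u-out I d∉)) (-‿cong (*-congˡ (o-out I d∉))))
                               (-‿cong (*-congˡ (o-out I d∉))))
        (solve 1 (λ a → a :* con (+ 0) :- a :* con (+ 0) :- a :* con (+ 0) := con (+ 0)) refl _)

      Above-D : ∀ i {j} → Above (Mem I) i j → Above D i j
      Above-D zero    _ = tt
      Above-D (suc i) m = mem⇒D {I} m

      Left-D : ∀ {i} j → Left (Mem I) i j → Left D i j
      Left-D zero    _ = tt
      Left-D (suc j) m = mem⇒D {I} m

      bw-out : ∀ {i j} → ¬ D i j → b i j * w I i j ≈ 0#
      bw-out {i} {j} d∉ with above? I i j | left? I i j
      ... | no _  | _     = solve 2 (λ a c → a :* (con (+ 0) :* c) := con (+ 0)) refl _ _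
      ... | yes _ | no _  = solve 1 (λ a → a :* (con (+ 1) :* con (+ 0)) := con (+ 0)) refl _
      ... | yes a | yes l = trans (*-congʳ (b-zero i j d∉ (Above-D i a) (Left-D j l))) (zeroˡ _)

      guard≈ : ∀ i j → guard f i j ≈ b i j * w I i j + g i j
      guard≈ i j with D? i j
      ... | yes _ = solve 4
          (λ b w o u → b :* ((w :- o) :- (o :- u)) := b :* w :+ (b :* u :- b :* o :- b :* o)) refl
              _ _ _ _
      ... | no d∉ = sym (trans (+-cong (bw-out d∉) (g-out d∉)) (+-identityˡ _))

  -- Comparing coefficients by adding one cell

  δ-refl : ∀ i → δ i i ≈ 1#
  δ-refl zero    = refl
  δ-refl (suc i) = δ-refl i

  δ-≢ : ∀ {i j} → i ≢ j → δ i j ≈ 0#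
  δ-≢ {zero}  {zero}  i≢j = contradiction ≡.refl i≢j
  δ-≢ {zero}  {suc j} i≢j = refl
  δ-≢ {suc i} {zero}  i≢j = refl
  δ-≢ {suc i} {suc j} i≢j = δ-≢ (i≢j ∘ ≡.cong suc)

  -- One added cell cannot be both successors of the same box, so no product of two increments
  -- survives in `u`.
  δ-suc-* : ∀ i k → δ (suc i) k * δ i k ≈ 0#
  δ-suc-* i k with i ℕ.≟ k
  ... | yes ≡.refl = trans (*-congʳ (δ-≢ {suc i} {i} ℕ.1+n≢n)) (zeroˡ _)
  ... | no i≢k     = trans (*-congˡ (δ-≢ i≢k)) (zeroʳ _)

  -- Adding (k , l) affects `o` at (k , l) and `u` at the two predecessors of (k , l). At a
  -- predecessor, `u` changes only if its other successor is absent from `I`; this is the factor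
  -- `1# - o`.
  module Difference (c e : ℕ → ℕ → Carrier) (I J : OrderIdeal) {k l} (d : D k l)
                    (o-J : ∀ i j → o J i j ≈ o I i j + δ i k * δ j l) where

    G : OrderIdeal → Carrier
    G I = □ height width λ i j → c i j * o I i j + e i j * u I i j

    private
      A B C : ℕ → ℕ → Carrier
      A i j = c i j * (δ i k * δ j l)
      B i j = (e i j * (1# - o I i (suc j))) * (δ (suc i) k * δ j l)
      C i j = (e i j * (1# - o I (suc i) j)) * (δ i k * δ (suc j) l)

      pointwise : ∀ i j → c i j * o J i j + e i j * u J i j ≈
                  (c i j * o I i j + e i j * u I i j) + (A i j + (B i j + C i j))
      pointwise i j = begin
        c i j * o J i j + e i j * u J i j
          ≈⟨ +-cong (*-congˡ (o-J i j)) (*-congˡ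
               (+-cong (+-cong (o-J (suc i) j) (o-J i (suc j)))
                   (-‿cong (*-cong (o-J (suc i) j) (o-J i (suc j)))))) ⟩
        c i j * (o I i j + δ i k * δ j l) + e i j *
            ((o I (suc i) j + δ (suc i) k * δ j l) ∨ (o I i (suc j) + δ i k * δ (suc j) l))
          ≈⟨ solve 9 (λ c e o p q a a' b b' →
               c :* (o :+ a :* b) :+ e :*
                   ((p :+ a' :* b) :+ (q :+ a :* b') :- (p :+ a' :* b) :* (q :+ a :* b'))
               := (c :* o :+ e :* (p :+ q :- p :* q)) :+
                   (c :* (a :* b) :+ ((e :* (con (+ 1) :- q)) :* (a' :* b)
                  :+ (e :* (con (+ 1) :- p)) :* (a :* b'))) :- e :* b :* b' :* (a' :* a)) refl
               (c i j) (e i j) (o I i j) (o I (suc i) j) (o I i (suc j)) (δ i k) (δ (suc i) k)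
                   (δ j l) (δ (suc j) l) ⟩
        (c i j * o I i j + e i j * u I i j) + (A i j + (B i j + C i j))
          - e i j * δ j l * δ (suc j) l * (δ (suc i) k * δ i k)
          ≈⟨ +-congˡ (-‿cong (trans (*-congˡ (δ-suc-* i k)) (zeroʳ _))) ⟩
        (c i j * o I i j + e i j * u I i j) + (A i j + (B i j + C i j)) - 0#
          ≈⟨ solve 1 (λ x → x :- con (+ 0) := x) refl _ ⟩
        (c i j * o I i j + e i j * u I i j) + (A i j + (B i j + C i j)) ∎

    difference : G J ≈ G I + (c k l + (shift (λ i → e i l * (1# - o I i (suc l))) k
                                       + shift (λ j → e k j * (1# - o I (suc k) j)) l))
    difference = begin
      G J   ≈⟨ □-cong height width pointwise ⟩
      □ height width (λ i j → (c i j * o I i j + e i j * u I i j) + (A i j + (B i j + C i j)))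
            ≈⟨ □-+ height width _ (λ i j → A i j + (B i j + C i j)) ⟩
      G I + □ height width (λ i j → A i j + (B i j + C i j))
            ≈⟨ +-congˡ (trans (□-+ height width A (λ i j → B i j + C i j))
                (+-congˡ (□-+ height width B C))) ⟩
      G I + (□ height width A + (□ height width B + □ height width C))
        ≈⟨ +-congˡ (+-cong (□-δ c k< l<)
             (+-cong (□-δ-sucˡ (λ i j → e i j * (1# - o I i (suc j))) k< l<)
             (□-δ-sucʳ (λ i j → e i j * (1# - o I (suc i) j)) k< l<))) ⟩
      _ ∎
      where
      k< = proj₁ (D-bounded d)
      l< = proj₂ (D-bounded d)

  -- Two ideals that differ by the cell (k , l); whether they contain its neighbour
  -- (k + 1 , l - 1), when that is a cell of λ, depends on n.
  module _ (k l n : ℕ) (n≤l : n ≤ l) where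

    private
      -- The rectangle up to (k , l) with the first `n` boxes of row k + 1 attached. As n ≤ l, the
      -- box (k + 1 , l) stays out, so (k , l) can be removed.
      Hook Hook⁻ : ℕ → ℕ → Set
      Hook  i j = (i ≤ k × j ≤ l) ⊎ (i ≤ suc k × j ℕ.< n)
      Hook⁻ i j = ((i ≤ k × j ≤ l) × ¬ (i ≡ k × j ≡ l)) ⊎ (i ≤ suc k × j ℕ.< n)

      hook? : ∀ i j → Dec (Hook i j)
      hook? i j = ((i ℕ.≤? k) ×-dec (j ℕ.≤? l)) ⊎-dec ((i ℕ.≤? suc k) ×-dec (j ℕ.<? n))

      hook⁻? : ∀ i j → Dec (Hook⁻ i j)
      hook⁻? i j = (((i ℕ.≤? k) ×-dec (j ℕ.≤? l)) ×-dec ¬? ((i ℕ.≟ k) ×-dec (j ℕ.≟ l)))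
                   ⊎-dec ((i ℕ.≤? suc k) ×-dec (j ℕ.<? n))

      hook-down : ∀ {i j i′ j′} → i ≤ i′ → j ≤ j′ → Hook i′ j′ → Hook i j
      hook-down i≤ j≤ (inj₁ (r , s)) = inj₁ (≤-trans i≤ r , ≤-trans j≤ s)
      hook-down i≤ j≤ (inj₂ (r , s)) = inj₂ (≤-trans i≤ r , ≤-trans (s≤s j≤) s)

      hook⁻-down : ∀ {i j i′ j′} → i ≤ i′ → j ≤ j′ → Hook⁻ i′ j′ → Hook⁻ i j
      hook⁻-down i≤ j≤ (inj₁ ((r , s) , ≢kl)) = inj₁ ((≤-trans i≤ r , ≤-trans j≤ s) ,
        λ { (≡.refl , ≡.refl) → ≢kl (ℕ.≤-antisym r i≤ , ℕ.≤-antisym s j≤) })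
      hook⁻-down i≤ j≤ (inj₂ (r , s)) = inj₂ (≤-trans i≤ r , ≤-trans (s≤s j≤) s)

    hook hook⁻ : OrderIdeal
    hook  = restrict hook? hook-down
    hook⁻ = restrict hook⁻? hook⁻-down

    hook⁻-right : ∀ {i} → o hook⁻ i (suc l) ≈ 0#
    hook⁻-right {i} = χ-false (mem? hook⁻ i (suc l)) λ m → excluded (restrict⁻ hook⁻? hook⁻-down m)
      where
      excluded : ¬ Hook⁻ i (suc l)
      excluded (inj₁ ((_ , l<l) , _)) = ℕ.1+n≰n l<l
      excluded (inj₂ (_ , l<n))       = ℕ.1+n≰n (≤-trans (n≤1+n _) (≤-trans l<n n≤l))

    hook⁻-below-in : ∀ {j} → j ℕ.< n → D (suc k) j → o hook⁻ (suc k) j ≈ 1#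
    hook⁻-below-in j<n d =
        χ-true (mem? hook⁻ _ _) (restrict⁺ hook⁻? hook⁻-down d (inj₂ (≤-refl , j<n)))

    hook⁻-below-out : ∀ {j} → n ≤ j → o hook⁻ (suc k) j ≈ 0#
    hook⁻-below-out {j} n≤j = χ-false (mem? hook⁻ _ _) λ m →
        excluded (restrict⁻ hook⁻? hook⁻-down m)
      where
      excluded : ¬ Hook⁻ (suc k) j
      excluded (inj₁ ((k<k , _) , _)) = ℕ.1+n≰n k<k
      excluded (inj₂ (_ , j<n))       = ℕ.<⇒≱ j<n n≤j

    o-elsewhere : ∀ {i j} → ¬ (i ≡ k × j ≡ l) → o hook i j ≈ o hook⁻ i j
    o-elsewhere {i} {j} ≢kl = χ-cong (mem? hook i j) (mem? hook⁻ i j)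
      (λ m → restrict⁺ hook⁻? hook⁻-down (mem⇒D {hook} m)
          (Sum.map₁ (_, ≢kl) (restrict⁻ hook? hook-down m)))
      (λ m → restrict⁺ hook? hook-down (mem⇒D {hook⁻} m)
          (Sum.map₁ proj₁ (restrict⁻ hook⁻? hook⁻-down m)))

    o-hook : D k l → ∀ i j → o hook i j ≈ o hook⁻ i j + δ i k * δ j l
    o-hook d i j with i ℕ.≟ k | j ℕ.≟ l
    ... | yes ≡.refl | yes ≡.refl = begin
      o hook k l
          ≈⟨ χ-true (mem? hook k l) (restrict⁺ hook? hook-down d (inj₁ (≤-refl , ≤-refl))) ⟩
      1#
          ≈⟨ solve 0 (con (+ 1) := con (+ 0) :+ con (+ 1) :* con (+ 1)) refl ⟩
      0# + 1# * 1#
        ≈⟨ +-cong (χ-false (mem? hook⁻ k l) λ m → excluded (restrict⁻ hook⁻? hook⁻-down m))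
             (*-cong (δ-refl k) (δ-refl l)) ⟨
      o hook⁻ k l + δ k k * δ l l     ∎
      where
      excluded : ¬ Hook⁻ k l
      excluded (inj₁ (_ , ≢kl)) = ≢kl (≡.refl , ≡.refl)
      excluded (inj₂ (_ , l<n)) = ℕ.<⇒≱ l<n n≤l
    ... | no i≢k | _ = trans (o-elsewhere (i≢k ∘ proj₁))
        (sym (trans (+-congˡ (trans (*-congʳ (δ-≢ i≢k)) (zeroˡ _))) (+-identityʳ _)))
    ... | yes _ | no j≢l =
        trans (o-elsewhere (j≢l ∘ proj₂))
            (sym (trans (+-congˡ (trans (*-congˡ (δ-≢ j≢l)) (zeroʳ _))) (+-identityʳ _)))

-- Relations between the constant, the toggles and the indicators

module ToggleabilitySpaces {c ℓ} (R : CommutativeRing c ℓ)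
  (torsionFree : ∀ n {x} → CommutativeRing._≈_ R
    (MonoidMult._×_ (CommutativeRing.+-monoid R) (suc n) x) (CommutativeRing.0# R) →
    CommutativeRing._≈_ R x (CommutativeRing.0# R))
  (lam : Partition) where

  open CommutativeRing R hiding (zero)
  open SemiringSum semiring using (sum; sum-cong-≋)
  open CommutativeMonoidMult +-commutativeMonoid using (×-homo-+; ×-distrib-+) renaming (_×_ to _·_)
  open IntegerCoefficients R using (solve; _:=_; _:+_; _:*_; _:-_; :-_; con)
  open FiniteSums R
  open LinearForms R
  open SetoidReasoning setoid
  open Diagram lam
  open Ferrers lam using (𝒫)
  open FinitePoset 𝒫 using (size)
  open OrderIdeals 𝒫
  open ToggleSums R lam

  -- Extension by zero makes `AddableZero` hold for every coefficient vector.
  ext : Vector Carrier size → ℕ → ℕ → Carrier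
  ext b i j with D? i j
  ... | yes d = b (proj₁ (cellAt d))
  ... | no _  = 0#

  ext-cell : ∀ b p → ext b (row p) (col p) ≈ b p
  ext-cell b p with D? (row p) (col p)
  ... | no d∉ = contradiction (D-cell p) d∉
  ... | yes d = reflexive
      (≡.cong b (position-injective (proj₁ (proj₂ (cellAt d))) (proj₂ (proj₂ (cellAt d)))))

  ext-out : ∀ b {i j} → ¬ D i j → ext b i j ≈ 0#
  ext-out b {i} {j} d∉ with D? i j
  ... | yes d = contradiction d d∉
  ... | no _  = refl

  ext-≈ : ∀ b {f : ℕ → ℕ → Carrier} → (∀ p → b p ≈ f (row p) (col p)) →
          ∀ {i j} → D i j → ext b i j ≈ f i j
  ext-≈ b {f} b≈f d with cellAt d
  ... | p , ≡.refl , ≡.refl = trans (ext-cell b p) (b≈f p)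

  sum-ext : ∀ b {f : Fin size → Carrier} {g : ℕ → ℕ → Carrier} → (∀ p → f p ≈ g (row p) (col p)) →
            (∀ i j → ¬ D i j → g i j ≈ 0#) →
            sum (λ p → b p * f p) ≈ □ height width (λ i j → ext b i j * g i j)
  sum-ext b {g = g} f≈g g-out = trans
    (sum-cong-≋ λ p → *-cong (sym (ext-cell b p)) (f≈g p))
    (sum-cells-supported {f = λ i j → ext b i j * g i j} (λ i j _ → refl)
        (λ i j d∉ → trans (*-congˡ (g-out i j d∉)) (zeroʳ _)))

  -- The form to which a linear combination of `const 1# ∷ᵛ 𝒯` unfolds.
  affine : Carrier → (Fin size → Carrier) → OrderIdeal → Carrier
  affine a b I = a * 1# + sum λ p → b p * 𝒯 p I

  laplacian mixed : (ℕ → ℕ → Carrier) → ℕ → ℕ → Carrier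
  laplacian b i j = b (suc i) j + b i (suc j) - b i j - b i j
  mixed b i j = b i j - b (suc i) (suc j)

  affine≈ : ∀ a (b : ℕ → ℕ → Carrier) → AddableZero b → ∀ I →
            affine a (λ p → b (row p) (col p)) I ≈
            (a + b 0 0) + □ height width (λ i j → laplacian b i j * o I i j + mixed b i j * u I i j)
  affine≈ a b b-zero I =
    trans (+-cong (*-identityʳ a) (toggle-sum b I b-zero)) (sym (+-assoc _ _ _))

  -- Treats three cases at once: on λ the pair of `c₁` and `c₂` is (0, 0) for independence, (c, 0)
  -- for I_T and (c, -c) for A_T.
  module Relations (a : Carrier) (b : Vector Carrier size) (c₁ c₂ : ℕ → ℕ → Carrier)
    (eq : ∀ I → affine a b I ≈ □ height width (λ i j → c₁ i j * o I i j + c₂ i j * u I i j)) where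

    b̂ c′ e : ℕ → ℕ → Carrier
    b̂ = ext b
    c′ i j = laplacian b̂ i j - c₁ i j
    e  i j = mixed b̂ i j - c₂ i j

    private
      G : OrderIdeal → Carrier
      G I = □ height width (λ i j → c′ i j * o I i j + e i j * u I i j)

      G-zero : ∀ I → (a + b̂ 0 0) + G I ≈ 0#
      G-zero I = begin
        k + G I
            ≈⟨ solve 3 (λ k g h → k :+ g := (k :+ (g :+ h)) :- h) refl k (G I) H ⟩
        k + (G I + H) - H      ≈⟨ +-congʳ (+-congˡ (□-+ height width _ _)) ⟨
        k + □ height width _ - H ≈⟨ +-congʳ (+-congˡ (□-cong height width λ i j →
          solve 6 (λ l c m d o u → (l :- c) :* o :+ (m :- d) :* u :+ (c :* o :+ d :* u) :=
              l :* o :+ m :* u) refl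
            (laplacian b̂ i j) (c₁ i j) (mixed b̂ i j) (c₂ i j) (o I i j) (u I i j))) ⟩
        k + □ height width (λ i j → laplacian b̂ i j * o I i j + mixed b̂ i j * u I i j) - H
          ≈⟨ +-congʳ (affine≈ a b̂ (λ i j d∉ _ _ → ext-out b d∉) I) ⟨
        affine a (λ p → b̂ (row p) (col p)) I - H
          ≈⟨ +-congʳ (+-congˡ (sum-cong-≋ λ p → *-congʳ (ext-cell b p))) ⟩
        affine a b I - H       ≈⟨ +-congʳ (eq I) ⟩
        H - H                  ≈⟨ -‿inverseʳ H ⟩
        0#                     ∎
        where
        k = a + b̂ 0 0
        H = □ height width (λ i j → c₁ i j * o I i j + c₂ i j * u I i j)

      G-equal : ∀ I J → G I ≈ G J
      G-equal I J = begin
        G I                    ≈⟨ solve 2 (λ k g → g := (k :+ g) :- k) refl k (G I) ⟩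
        k + G I - k            ≈⟨ +-congʳ (trans (G-zero I) (sym (G-zero J))) ⟩
        k + G J - k            ≈⟨ solve 2 (λ k g → (k :+ g) :- k := g) refl k (G J) ⟩
        G J                    ∎
        where k = a + b̂ 0 0

      ∅ : OrderIdeal
      ∅ = restrict {S = λ _ _ → ⊥} (λ _ _ → no λ ()) (λ _ _ ())

      o-∅ : ∀ i j → o ∅ i j ≈ 0#
      o-∅ i j = χ-false (mem? ∅ i j) (restrict⁻ {S = λ _ _ → ⊥} (λ _ _ → no λ ()) (λ _ _ ()))

    -- On the empty ideal all indicators vanish and only the constants remain.
    constant-term : a ≈ - b̂ 0 0
    constant-term = begin
      a
          ≈⟨ solve 3 (λ a b g → a := (a :+ b) :+ g :+ (:- g :- b)) refl a (b̂ 0 0) (G ∅) ⟩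
      (a + b̂ 0 0) + G ∅ + (- G ∅ - b̂ 0 0)
        ≈⟨ +-cong (G-zero ∅) (+-congʳ (-‿cong (□-zero height width G-∅))) ⟩
      0# + (- 0# - b̂ 0 0)
          ≈⟨ solve 1 (λ b → con (+ 0) :+ (:- con (+ 0) :- b) := :- b) refl (b̂ 0 0) ⟩
      - b̂ 0 0                    ∎
      where
      G-∅ : ∀ i j → c′ i j * o ∅ i j + e i j * u ∅ i j ≈ 0#
      G-∅ i j = trans (+-cong (*-congˡ (o-∅ i j))
          (*-congˡ (+-cong (+-cong (o-∅ _ _) (o-∅ _ _)) (-‿cong (*-cong (o-∅ _ _) (o-∅ _ _))))))
        (solve 2 (λ c e → c :* con (+ 0) :+ e :*
            (con (+ 0) :+ con (+ 0) :- con (+ 0) :* con (+ 0)) := con (+ 0)) refl _ _)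

    private
      hook-relation : ∀ {k l} → D k l → ∀ n (n≤l : n ≤ l) →
        c′ k l + (shift (λ i → e i l) k
                  + shift (λ j → e k j * (1# - o (hook⁻ k l n n≤l) (suc k) j)) l) ≈ 0#
      hook-relation {k} {l} d n n≤l = begin
        c′ k l + (shift (λ i → e i l) k + S)
          ≈⟨ +-congˡ (+-congʳ (shift-cong k)) ⟨
        c′ k l + (shift (λ i → e i l * (1# - o I i (suc l))) k + S)
          ≈⟨ solve 2 (λ g x → x := (g :+ x) :- g) refl (G I) _ ⟩
        G I + (c′ k l + (shift (λ i → e i l * (1# - o I i (suc l))) k + S)) - G I
          ≈⟨ +-congʳ (Difference.difference c′ e I (hook k l n n≤l) d (o-hook k l n n≤l d)) ⟨
        G (hook k l n n≤l) - G I
          ≈⟨ +-congʳ (G-equal (hook k l n n≤l) I) ⟩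
        G I - G I
          ≈⟨ -‿inverseʳ (G I) ⟩
        0# ∎
        where
        I = hook⁻ k l n n≤l
        S = shift (λ j → e k j * (1# - o I (suc k) j)) l
        shift-cong : ∀ m → shift (λ i → e i l * (1# - o I i (suc l))) m ≈ shift (λ i → e i l) m
        shift-cong zero    = refl
        shift-cong (suc i) = trans (*-congˡ (+-congˡ (-‿cong (hook⁻-right k l n n≤l))))
          (solve 1 (λ x → x :* (con (+ 1) :- con (+ 0)) := x) refl (e i l))

    -- `G` takes the same value on all ideals. With n = 0 both row k + 1 and column l + 1 are
    -- absent, so adding (k , l) changes `u` at both predecessors.
    first-order : ∀ k l → D k l → c′ k l + (shift (λ i → e i l) k + shift (e k) l) ≈ 0#
    first-order k l d = trans (+-congˡ (+-congˡ (sym (shift-cong l)))) (hook-relation d 0 z≤n)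
      where
      shift-cong : ∀ m → shift (λ j → e k j * (1# - o (hook⁻ k l 0 z≤n) (suc k) j)) m ≈
                           shift (e k) m
      shift-cong zero    = refl
      shift-cong (suc j) = trans (*-congˡ (+-congˡ (-‿cong (hook⁻-below-out k l 0 z≤n z≤n))))
        (solve 1 (λ x → x :* (con (+ 1) :- con (+ 0)) := x) refl (e k j))

    -- Two relations for adding (k , l + 1) are subtracted, one without (k + 1 , l) in the ideal and
    -- one with it; only in the former does `u` at (k , l) change.
    second-order : ∀ {k l} → Inner k l → e k l ≈ 0#
    second-order {k} {l} (d₁₀ , d₀₁) = begin
      e k l
        ≈⟨ solve 3 (λ c s e → e := (c :+ (s :+ e)) :- (c :+ (s :+ e :* (con (+ 1) :- con (+ 1)))))
             refl c″ s (e k l) ⟩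
      (c″ + (s + e k l)) - (c″ + (s + e k l * (1# - 1#)))
        ≈⟨ +-cong (first-order k (suc l) d₀₁)
             (-‿cong (trans
             (+-congˡ (+-congˡ
             (*-congˡ (+-congˡ
             (-‿cong (sym (hook⁻-below-in k (suc l) (suc l) ≤-refl ≤-refl d₁₀)))))))
             (hook-relation d₀₁ (suc l) ≤-refl))) ⟩
      0# - 0#                              ≈⟨ -‿inverseʳ 0# ⟩
      0#                                   ∎
      where
      c″ = c′ k (suc l)
      s  = shift (λ i → e i (suc l)) k

  -- Independence of the toggles and the constant

  -- Reduces the use of a known relation `z ≈ 0#` to a ring identity for the solver.
  ≈-from : ∀ {x y z} → z ≈ 0# → x ≈ y + z → x ≈ y
  ≈-from z≈0 x≈y+z = trans x≈y+z (trans (+-congˡ z≈0) (+-identityʳ _))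

  ·-zero : ∀ n {x} → x ≈ 0# → n · x ≈ 0#
  ·-zero zero    x≈0 = refl
  ·-zero (suc n) x≈0 = trans (+-cong x≈0 (·-zero n x≈0)) (+-identityˡ 0#)

  -- The recurrence has order two, so two consecutive values are carried. The second one reaches one
  -- index past `Q`, to the box just outside λ where `b̂` vanishes.
  progression : ∀ {Q : ℕ → Set} (f : ℕ → Carrier) → (∀ n → Q (suc n) → Q n) →
                (∀ n → Q (suc n) → f (2 ℕ.+ n) + f n ≈ f (suc n) + f (suc n)) →
                ∀ n → Q n → f n ≈ f 0 + n · (f 1 - f 0) × f (suc n) ≈ f 0 + suc n · (f 1 - f 0)
  progression f Q-down step zero    q =
    sym (+-identityʳ _) , solve 2 (λ x y → y := x :+ (y :- x :+ con (+ 0))) refl (f 0) (f 1)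
  progression f Q-down step (suc n) q with progression f Q-down step n (Q-down n q)
  ... | fₙ , fₙ₊₁ = fₙ₊₁ , (begin
    f (2 ℕ.+ n)
        ≈⟨ solve 2 (λ x y → x := (x :+ y) :- y) refl (f (2 ℕ.+ n)) (f n) ⟩
    f (2 ℕ.+ n) + f n - f n                   ≈⟨ +-cong (step n q) (-‿cong fₙ) ⟩
    f (suc n) + f (suc n) - (f 0 + n · α)     ≈⟨ +-congʳ (+-cong fₙ₊₁ fₙ₊₁) ⟩
    (f 0 + (α + n · α)) + (f 0 + (α + n · α)) - (f 0 + n · α)
      ≈⟨ solve 3 (λ x a m → (x :+ (a :+ m)) :+ (x :+ (a :+ m)) :- (x :+ m) :=
           x :+ (a :+ (a :+ m))) refl (f 0) α (n · α) ⟩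
    f 0 + (α + (α + n · α))                   ∎)
    where α = f 1 - f 0

  last-satisfying : ∀ {Q : ℕ → Set} → (∀ n → Dec (Q n)) → Q 0 → ∀ n → ¬ Q n →
                    ∃ λ m → Q m × ¬ Q (suc m)
  last-satisfying Q? q₀ zero    ¬q = contradiction q₀ ¬q
  last-satisfying Q? q₀ (suc n) ¬q with Q? n
  ... | yes q  = n , q , ¬q
  ... | no ¬q′ = last-satisfying Q? q₀ n ¬q′

  module Independence (a : Carrier) (b : Vector Carrier size)
      (affine-zero : ∀ I → affine a b I ≈ 0#) where

    open Relations a b (λ _ _ → 0#) (λ _ _ → 0#)
      (λ I → trans (affine-zero I) (sym (□-zero height width λ i j →
        solve 2 (λ x y → con (+ 0) :* x :+ con (+ 0) :* y := con (+ 0)) refl _ _)))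

    private
      row-down : ∀ j → D 0 (suc j) → D 0 j
      row-down j = D-down z≤n (n≤1+n _)

      column-down : ∀ i → D (suc i) 0 → D i 0
      column-down i = D-down (n≤1+n _) z≤n

      -- The value at (1 , j + 1) occurs in `first-order` through the Laplacian and, with the
      -- opposite sign, through `e 0 j`, and cancels.
      row-step : ∀ j → D 0 (suc j) → b̂ 0 (2 ℕ.+ j) + b̂ 0 j ≈ b̂ 0 (suc j) + b̂ 0 (suc j)
      row-step j d = ≈-from (first-order 0 (suc j) d)
        (solve 4 (λ x y z v → x :+ y :=
            (z :+ z) :+ ((v :+ x :- z :- z :- con (+ 0)) :+ (con (+ 0) :+ (y :- v :- con (+ 0)))))
          refl (b̂ 0 (2 ℕ.+ j)) (b̂ 0 j) (b̂ 0 (suc j)) (b̂ 1 (suc j)))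

      column-step : ∀ i → D (suc i) 0 → b̂ (2 ℕ.+ i) 0 + b̂ i 0 ≈ b̂ (suc i) 0 + b̂ (suc i) 0
      column-step i d = ≈-from (first-order (suc i) 0 d)
        (solve 4 (λ x y z v → x :+ y :=
            (z :+ z) :+ ((x :+ v :- z :- z :- con (+ 0)) :+ ((y :- v :- con (+ 0)) :+ con (+ 0))))
          refl (b̂ (2 ℕ.+ i) 0) (b̂ i 0) (b̂ (suc i) 0) (b̂ (suc i) 1))

      row-progression : ∀ j → D 0 j → b̂ 0 j ≈ b̂ 0 0 + j · (b̂ 0 1 - b̂ 0 0) ×
                        b̂ 0 (suc j) ≈ b̂ 0 0 + suc j · (b̂ 0 1 - b̂ 0 0)
      row-progression = progression {D 0} (b̂ 0) row-down row-step

      column-progression : ∀ i → D i 0 → b̂ i 0 ≈ b̂ 0 0 + i · (b̂ 1 0 - b̂ 0 0) ×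
                           b̂ (suc i) 0 ≈ b̂ 0 0 + suc i · (b̂ 1 0 - b̂ 0 0)
      column-progression = progression {λ i → D i 0} (λ i → b̂ i 0) column-down column-step

      α α′ : Carrier
      α  = b̂ 0 1 - b̂ 0 0
      α′ = b̂ 1 0 - b̂ 0 0

      -- The values along the first column and the first row form one arithmetic
      -- progression, which vanishes just outside the diagram at both ends.
      axes : D 0 0 → α ≈ 0# × α′ ≈ 0# × b̂ 0 0 ≈ 0#
      axes d₀ with last-satisfying (D? 0) d₀ width beyond-width
                 | last-satisfying (λ i → D? i 0) d₀ height beyond-height
      ... | n , dₙ , dₙ∉ | m , dₘ , dₘ∉ = α≈0 ,
          trans (≈-from α+α′≈0 (solve 2 (λ a b → a := :- b :+ (b :+ a)) refl α′ α))
              (trans (-‿cong α≈0) -0≈0) , b₀₀≈0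
        where
        -0≈0 : - 0# ≈ 0#
        -0≈0 = solve 0 (:- con (+ 0) := con (+ 0)) refl
        row-end : b̂ 0 0 + suc n · α ≈ 0#
        row-end = trans (sym (proj₂ (row-progression n dₙ))) (ext-out b dₙ∉)
        column-end : b̂ 0 0 + suc m · α′ ≈ 0#
        column-end = trans (sym (proj₂ (column-progression m dₘ))) (ext-out b dₘ∉)
        α+α′≈0 : α + α′ ≈ 0#
        α+α′≈0 = ≈-from (first-order 0 0 d₀)
          (solve 3 (λ x y z → (y :- z) :+ (x :- z) :=
              con (+ 0) :+ ((x :+ y :- z :- z :- con (+ 0)) :+ (con (+ 0) :+ con (+ 0))))
            refl (b̂ 1 0) (b̂ 0 1) (b̂ 0 0))
        α≈0 : α ≈ 0#
        -- From one vanishing end to the other there are `suc n` steps along the row and `suc m`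
        -- along the column.
        α≈0 = torsionFree (n ℕ.+ suc m) (begin
          (suc n ℕ.+ suc m) · α        ≈⟨ ×-homo-+ α (suc n) (suc m) ⟩
          suc n · α + suc m · α
              ≈⟨ solve 4 (λ z x y y′ → x :+ y := (z :+ x) :- (z :+ y′) :+ (y :+ y′)) refl (b̂ 0 0)
                  (suc n · α) (suc m · α) (suc m · α′) ⟩
          (b̂ 0 0 + suc n · α) - (b̂ 0 0 + suc m · α′) + (suc m · α + suc m · α′)
            ≈⟨ +-cong (+-cong row-end (-‿cong column-end))
                 (trans (sym (×-distrib-+ α α′ (suc m))) (·-zero (suc m) α+α′≈0)) ⟩
          0# - 0# + 0#
              ≈⟨ solve 0 (con (+ 0) :- con (+ 0) :+ con (+ 0) := con (+ 0)) refl ⟩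
          0#                           ∎)
        b₀₀≈0 : b̂ 0 0 ≈ 0#
        b₀₀≈0 = trans (sym (+-identityʳ _)) (trans (+-congˡ (sym (·-zero (suc n) α≈0))) row-end)

    private
      by-cases : ∀ {i j} → Dec (D i j) → (D i j → b̂ i j ≈ 0#) → b̂ i j ≈ 0#
      by-cases (yes d) in-D = in-D d
      by-cases (no d∉) in-D = ext-out b d∉

    -- Off the axes `first-order` says that twice the value at (i + 1 , j + 1) is the sum of the
    -- values at its two predecessors, so zeros spread inwards from the axes.
    ext-zero : ∀ i j → b̂ i j ≈ 0#
    ext-zero zero    j       = by-cases (D? 0 j) λ d →
      let α≈0 , _ , b₀₀≈0 = axes (D-down z≤n z≤n d) in
      trans (proj₁ (row-progression j d)) (trans (+-cong b₀₀≈0 (·-zero j α≈0)) (+-identityˡ 0#))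
    ext-zero (suc i) zero    = by-cases (D? (suc i) 0) λ d →
      let _ , α′≈0 , b₀₀≈0 = axes (D-down z≤n z≤n d) in
      trans (proj₁ (column-progression (suc i) d))
          (trans (+-cong b₀₀≈0 (·-zero (suc i) α′≈0)) (+-identityˡ 0#))
    ext-zero (suc i) (suc j) = by-cases (D? (suc i) (suc j)) λ d → torsionFree 1 (begin
      x + (x + 0#)                 ≈⟨ +-congˡ (+-identityʳ x) ⟩
      x + x                        ≈⟨ ≈-from (first-order (suc i) (suc j) d)
        (solve 5 (λ x p q r s → p :+ q :=
            x :+ x :+ ((r :+ s :- x :- x :- con (+ 0)) :+
                ((p :- s :- con (+ 0)) :+ (q :- r :- con (+ 0)))))
          refl x (b̂ i (suc j)) (b̂ (suc i) j) (b̂ (2 ℕ.+ i) (suc j)) (b̂ (suc i) (2 ℕ.+ j))) ⟨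
      b̂ i (suc j) + b̂ (suc i) j    ≈⟨ +-cong (ext-zero i (suc j)) (ext-zero (suc i) j) ⟩
      0# + 0#                      ≈⟨ +-identityˡ 0# ⟩
      0#                           ∎)
      where x = b̂ (suc i) (suc j)

  -- Functions constant along diagonals

  Params : Set c
  Params = Vector Carrier (length strip)

  -- Constant along diagonals, with value `t k` on that of the k-th cell of `strip` and zero on
  -- those without such a cell. At most one term is nonzero; the sum makes linearity in `t`
  -- immediate.
  β : Params → ℕ → ℕ → Carrier
  β t i j = sum λ k → t k * χ (sameDiagonal? (srow k) (scol k) i j)

  β-strip : ∀ t k {i j} → srow k ≡ i → scol k ≡ j → β t i j ≈ t k
  β-strip t k ≡.refl ≡.refl = trans
    (sum-single k λ l l≢k →
        trans (*-congˡ (χ-false (sameDiagonal? (srow l) (scol l) (srow k) (scol k))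
      λ eq → l≢k (strip-injective (border-diagonal (proj₁ (strip⁻ l)) (proj₁ (strip⁻ k)) eq))))
          (zeroʳ _))
    (trans (*-congˡ (χ-true (sameDiagonal? (srow k) (scol k) (srow k) (scol k)) ≡.refl))
        (*-identityʳ _))

  β-avoid : ∀ t {i j} → (∀ k → ¬ SameDiagonal (srow k) (scol k) i j) → β t i j ≈ 0#
  β-avoid t {i} {j} avoids = sum-zero λ k →
    trans (*-congˡ (χ-false (sameDiagonal? (srow k) (scol k) i j) (avoids k))) (zeroʳ _)

  β-diagonal : ∀ t i j → β t i j ≈ β t (suc i) (suc j)
  β-diagonal t i j = sum-cong-≋ λ k → *-congˡ (χ-cong
    (sameDiagonal? (srow k) (scol k) i j) (sameDiagonal? (srow k) (scol k) (suc i) (suc j))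
    (λ eq → ≡.trans (ℕ.+-suc (srow k) j) (≡.cong suc eq))
    (λ eq → ℕ.suc-injective (≡.trans (≡.sym (ℕ.+-suc (srow k) j)) eq)))

  β-linear : ∀ i j → IsLinear λ t → β t i j
  β-linear i j = _ , λ t → refl

  β-addable : ∀ t → AddableZero (β t)
  β-addable t i j d∉ above left = β-avoid t (strip-avoids-addable i j d∉ above left)

  β-corner : ∀ t {i j} → Border i j → Inner i j → β t i j ≈ 0#
  β-corner t border inner = β-avoid t λ k eq →
      corner k (border-diagonal (proj₁ (strip⁻ k)) border eq)
    where
    corner : ∀ k → ¬ (srow k ≡ _ × scol k ≡ _)
    corner k (≡.refl , ≡.refl) = proj₂ (strip⁻ k) inner

  β-outer : ∀ t (f : ℕ → ℕ → Carrier) → (∀ k → t k ≈ f (srow k) (scol k)) →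
            ∀ {i j} → Border i j → ¬ Inner i j → β t i j ≈ f i j
  β-outer t f t≈f border outer = at (strip⁺ border outer)
    where
    at : ∀ {i j} → (∃ λ k → srow k ≡ i × scol k ≡ j) → β t i j ≈ f i j
    at (k , ≡.refl , ≡.refl) = trans (β-strip t k ≡.refl ≡.refl) (t≈f k)

  inner? : ∀ i j → Dec (Inner i j)
  inner? i j = D? (suc i) j ×-dec D? i (suc j)

  -- The constant cancels the term `b 0 0` of `toggle-sum`, as it must: all `𝟏` and `𝒯⁻` vanish on
  -- the empty ideal.
  Φ : (ℕ → ℕ → Carrier) → OrderIdeal → Carrier
  Φ b = affine (- b 0 0) (λ p → b (row p) (col p))

  Φ≈ : ∀ b → AddableZero b → ∀ I →
       Φ b I ≈ □ height width (λ i j → laplacian b i j * o I i j + mixed b i j * u I i j)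
  Φ≈ b b-zero I = trans (affine≈ (- b 0 0) b b-zero I)
    (trans (+-congʳ (-‿inverseˡ _)) (+-identityˡ _))

  Φ-linear : ∀ (b : Params → ℕ → ℕ → Carrier) → (∀ i j → IsLinear λ t → b t i j) →
             ∀ I → IsLinear λ t → Φ (b t) I
  Φ-linear b b-linear I = linear-+ (linear-* (linear-neg (b-linear 0 0)) 1#)
    (linear-∑ λ p → linear-* (b-linear (row p) (col p)) (𝒯 p I))

  Φ-injective : ∀ b → (∀ I → Φ b I ≈ 0#) → ∀ {i j} → D i j → b i j ≈ 0#
  Φ-injective b Φ≈0 d = trans (sym (ext-≈ (λ p → b (row p) (col p)) {b} (λ p → refl) d))
    (Independence.ext-zero (- b 0 0) (λ p → b (row p) (col p)) Φ≈0 _ _)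

  combination-out : ∀ c₁ c₂ I {i j} → ¬ D i j → c₁ * o I i j + c₂ * u I i j ≈ 0#
  combination-out c₁ c₂ I d∉ = trans (+-cong (*-congˡ (o-out I d∉)) (*-congˡ (u-out I d∉)))
    (solve 2 (λ x y → x :* con (+ 0) :+ y :* con (+ 0) := con (+ 0)) refl c₁ c₂)

  affine≈Φ : ∀ {a b f} → a ≈ - ext b 0 0 → AddableZero f → (∀ i j → D i j → ext b i j ≈ f i j) →
             ∀ I → affine a b I ≈ Φ f I
  affine≈Φ {a} {b} {f} a≈ f-zero b≈f I = +-cong
    (*-congʳ (trans a≈ (-‿cong (origin (D? 0 0)))))
    (sum-cong-≋ λ p → *-congʳ (trans (sym (ext-cell b p)) (b≈f (row p) (col p) (D-cell p))))
    where
    origin : Dec (D 0 0) → ext b 0 0 ≈ f 0 0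
    origin (yes d) = b≈f 0 0 d
    -- Here λ is empty and the origin is itself a box that can be added.
    origin (no d∉) = trans (ext-out b d∉) (sym (f-zero 0 0 d∉ tt tt))

  -- The space I_T

  module IdealSpace where

    injective : ∀ t → (∀ I → Φ (β t) I ≈ 0#) → ∀ k → t k ≈ 0#
    injective t Φ≈0 k = trans (sym (β-strip t k ≡.refl ≡.refl))
      (Φ-injective (β t) Φ≈0 (proj₁ (proj₁ (strip⁻ k))))

    into : ∀ t → ∃ λ (c : Vector Carrier size) → ∀ I → Φ (β t) I ≈ sum λ p →
        c p * χ (p ∈? members I)
    into t = (λ p → laplacian (β t) (row p) (col p)) , λ I → trans (Φ≈ (β t) (β-addable t) I)
      (sym (trans (sum-cong-≋ λ p → *-congˡ (𝟏≈o I p))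
                  (sum-cells-supported (λ i j _ → term I i j) (λ i j → combination-out _ _ I))))
      where
      term : ∀ I i j → laplacian (β t) i j * o I i j ≈ laplacian (β t) i j * o I i j + mixed (β t)
          i j * u I i j
      term I i j = sym (trans
        (+-congˡ (trans (*-congʳ (trans (+-congʳ (β-diagonal t i j)) (-‿inverseʳ _))) (zeroˡ _)))
        (+-identityʳ _))

    module _ {a : Carrier} {b c : Vector Carrier size}
             (eq : ∀ I → affine a b I ≈ sum λ p → c p * χ (p ∈? members I)) where

      open Relations a b (ext c) (λ _ _ → 0#) (λ I → trans (eq I) (trans
        (sum-ext c (𝟏≈o I) (λ i j → o-out I))
        (□-cong height width λ i j →
            solve 3 (λ c o u → c :* o := c :* o :+ con (+ 0) :* u) refl _ _ _)))

      private
        t : Params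
        t k = b̂ (srow k) (scol k)

        diagonal-step : ∀ {i j} → Inner i j → b̂ i j ≈ b̂ (suc i) (suc j)
        diagonal-step inner = ≈-from (second-order inner)
          (solve 2 (λ x y → x := y :+ (x :- y :- con (+ 0))) refl _ _)

        -- The value is carried along the diagonal to its border cell. At a corner one further step
        -- leads to the zero outside λ; at any other border cell the value is the parameter itself.
        -- `n` bounds the rows that remain.
        b̂≈β : ∀ n i j → D i j → height ≤ i ℕ.+ n → b̂ i j ≈ β t i j
        b̂≈β zero    i j d h≤ =
            contradiction (proj₁ (D-bounded d)) (ℕ.≤⇒≯ (≡.subst (height ≤_) (ℕ.+-identityʳ i) h≤))
        b̂≈β (suc n) i j d h≤ = by-cases (D? (suc i) (suc j)) (inner? i j)
          where
          by-cases : Dec (D (suc i) (suc j)) → Dec (Inner i j) → b̂ i j ≈ β t i j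
          by-cases (yes d₁₁) _           = trans
            (diagonal-step (D-down ≤-refl (n≤1+n j) d₁₁ , D-down (n≤1+n i) ≤-refl d₁₁))
            (trans (b̂≈β n (suc i) (suc j) d₁₁ (≡.subst (height ≤_) (ℕ.+-suc i n) h≤))
                (sym (β-diagonal t i j)))
          by-cases (no d₁₁∉) (yes inner) = trans (diagonal-step inner)
            (trans (ext-out b d₁₁∉) (sym (β-corner t (d , d₁₁∉) inner)))
          by-cases (no d₁₁∉) (no outer)  = sym (β-outer t b̂ (λ k → refl) (d , d₁₁∉) outer)

      onto : ∃ λ t → ∀ I → affine a b I ≈ Φ (β t) I
      onto = t , affine≈Φ {a} {b} constant-term (β-addable t)
          (λ i j d → b̂≈β height i j d (ℕ.m≤n+m height i))

  -- The space A_T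

  module AntichainSpace where

    -- Solves the recurrence of A_T inwards from the values of `β` outside λ. The number is fuel:
    -- every call raises i + j, which stays below `height ℕ.+ width` on λ.
    γ : Params → ℕ → ℕ → ℕ → Carrier
    γ t zero    i j = β t i j
    γ t (suc n) i j =
      if does (D? i j) then γ t n (suc i) j + γ t n i (suc j) - γ t n (suc i) (suc j) else β t i j

    γ-linear : ∀ n i j → IsLinear λ t → γ t n i j
    γ-linear zero    i j = β-linear i j
    γ-linear (suc n) i j = linear-if (does (D? i j))
      (linear-+ (linear-+ (γ-linear n (suc i) j) (γ-linear n i (suc j)))
                (linear-neg (γ-linear n (suc i) (suc j))))
      (β-linear i j)

    D-sum : ∀ {i j} → D i j → i ℕ.+ j ℕ.< height ℕ.+ width
    D-sum d = ℕ.+-mono-< (proj₁ (D-bounded d)) (proj₂ (D-bounded d))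

    Fuel : ℕ → ℕ → ℕ → Set
    Fuel n i j = height ℕ.+ width ≤ i ℕ.+ j ℕ.+ n

    fuel-zero : ∀ {i j} → Fuel 0 i j → ¬ D i j
    fuel-zero {i} {j} enough d =
        ℕ.<⇒≱ (D-sum d) (≡.subst (height ℕ.+ width ≤_) (ℕ.+-identityʳ _) enough)

    fuel₁₀ : ∀ {n i j} → Fuel (suc n) i j → Fuel n (suc i) j
    fuel₁₀ {n} {i} {j} = ≡.subst (height ℕ.+ width ≤_) (ℕ.+-suc (i ℕ.+ j) n)

    fuel₀₁ : ∀ {n i j} → Fuel (suc n) i j → Fuel n i (suc j)
    fuel₀₁ {n} {i} {j} enough =
      ≡.subst (λ m → height ℕ.+ width ≤ m ℕ.+ n) (≡.sym (ℕ.+-suc i j)) (fuel₁₀ {n} {i} {j} enough)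

    fuel₁₁ : ∀ {n i j} → Fuel (suc n) i j → Fuel n (suc i) (suc j)
    fuel₁₁ {n} {i} {j} enough = ≤-trans (fuel₀₁ {n} {i} {j} enough) (n≤1+n _)

    -- With this much fuel every branch leaves λ before running out, and outside λ the value no
    -- longer depends on the fuel.
    γ-stable : ∀ t n i j → Fuel n i j → γ t n i j ≈ γ t (suc n) i j
    γ-stable t zero    i j enough = sym (if-false (D? i j) (fuel-zero {i} {j} enough))
    γ-stable t (suc n) i j enough = if-cong (does (D? i j))
      (+-cong (+-cong (γ-stable t n (suc i) j (fuel₁₀ {n} {i} {j} enough))
                      (γ-stable t n i (suc j) (fuel₀₁ {n} {i} {j} enough)))
              (-‿cong (γ-stable t n (suc i) (suc j) (fuel₁₁ {n} {i} {j} enough))))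
      refl

    θ : Params → ℕ → ℕ → Carrier
    θ t = γ t (height ℕ.+ width)

    θ-in : ∀ t {i j} → D i j → θ t i j ≈ θ t (suc i) j + θ t i (suc j) - θ t (suc i) (suc j)
    θ-in t {i} {j} d =
      trans (γ-stable t (height ℕ.+ width) i j (ℕ.m≤n+m _ (i ℕ.+ j))) (if-true (D? i j) d)

    θ-out : ∀ t {i j} → ¬ D i j → θ t i j ≈ β t i j
    θ-out t {i} {j} d∉ =
      trans (γ-stable t (height ℕ.+ width) i j (ℕ.m≤n+m _ (i ℕ.+ j))) (if-false (D? i j) d∉)

    θ-addable : ∀ t → AddableZero (θ t)
    θ-addable t i j d∉ above left = trans (θ-out t d∉) (β-addable t i j d∉ above left)

    θ-row : ∀ t {j} → ¬ D 0 j → θ t 0 j ≈ 0#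
    θ-row t d∉ = trans (θ-out t d∉) (β-avoid t (strip-avoids-row d∉))

    θ-column : ∀ t {i} → ¬ D i 0 → θ t i 0 ≈ 0#
    θ-column t d∉ = trans (θ-out t d∉) (β-avoid t (strip-avoids-column d∉))

    -- Farther from the diagram θ still has the values of β, on which the relations
    -- put no constraint.
    Near : ℕ → ℕ → Set
    Near zero    j       = ⊤
    Near (suc i) zero    = ⊤
    Near (suc i) (suc j) = D i j

    near₁₀ : ∀ i j → D i j → Near (suc i) j
    near₁₀ i zero    d = tt
    near₁₀ i (suc j) d = D-down ≤-refl (n≤1+n j) d

    near₀₁ : ∀ i j → D i j → Near i (suc j)
    near₀₁ zero    j d = tt
    near₀₁ (suc i) j d = D-down (n≤1+n i) ≤-refl d

    module _ (t : Params) (Φ≈0 : ∀ I → Φ (θ t) I ≈ 0#) where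

      private
        by-cases : ∀ {i j} → Dec (D i j) → (¬ D i j → θ t i j ≈ 0#) → θ t i j ≈ 0#
        by-cases (yes d) out = Φ-injective (θ t) Φ≈0 d
        by-cases (no d∉) out = out d∉

      -- Independence gives zeros only on λ, while the parameters sit just outside. The recurrence
      -- at (i , j), solved for its value at (i + 1 , j + 1), carries the zeros outwards.
      θ-zero : ∀ i j → Near i j → θ t i j ≈ 0#
      θ-zero zero    j       _ = by-cases (D? 0 j) (θ-row t)
      θ-zero (suc i) zero    _ = by-cases (D? (suc i) 0) (θ-column t)
      θ-zero (suc i) (suc j) d = begin
        x₁₁
            ≈⟨ solve 3 (λ x y z → z := x :+ y :- (x :+ y :- z)) refl x₁₀ x₀₁ x₁₁ ⟩
        x₁₀ + x₀₁ - (x₁₀ + x₀₁ - x₁₁)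
          ≈⟨ +-cong (+-cong (θ-zero (suc i) j (near₁₀ i j d)) (θ-zero i (suc j) (near₀₁ i j d)))
               (-‿cong (trans (sym (θ-in t d)) (Φ-injective (θ t) Φ≈0 d))) ⟩
        0# + 0# - 0#
            ≈⟨ solve 0 (con (+ 0) :+ con (+ 0) :- con (+ 0) := con (+ 0)) refl ⟩
        0#                       ∎
        where
        x₁₀ = θ t (suc i) j
        x₀₁ = θ t i (suc j)
        x₁₁ = θ t (suc i) (suc j)

      injective : ∀ k → t k ≈ 0#
      injective k = begin
        t k                                  ≈⟨ β-strip t k ≡.refl ≡.refl ⟨
        β t (srow k) (scol k)                ≈⟨ β-diagonal t _ _ ⟩
        β t (suc (srow k)) (suc (scol k))    ≈⟨ θ-out t (proj₂ (proj₁ (strip⁻ k))) ⟨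
        θ t (suc (srow k)) (suc (scol k))
            ≈⟨ θ-zero (suc (srow k)) (suc (scol k)) (proj₁ (proj₁ (strip⁻ k))) ⟩
        0#                                   ∎

    into : ∀ t → ∃ λ (c : Vector Carrier size) → ∀ I → Φ (θ t) I ≈ sum λ p → c p * 𝒯⁻ p I
    into t = (λ p → - mixed (θ t) (row p) (col p)) , λ I → trans (Φ≈ (θ t) (θ-addable t) I)
      (sym (trans (sum-cong-≋ λ p → *-congˡ (𝒯⁻≈ I p))
                  (sum-cells-supported (λ i j → term I i j) (λ i j → combination-out _ _ I))))
      where
      term : ∀ I i j → D i j → - mixed (θ t) i j * (o I i j - u I i j) ≈
             laplacian (θ t) i j * o I i j + mixed (θ t) i j * u I i j
      term I i j d = begin
        - (x - x₁₁) * (o I i j - u I i j)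
          ≈⟨ solve 4 (λ x y o u → :- (x :- y) :* (o :- u) := ((y :- x) :* o) :+ (x :- y) :* u)
              refl x x₁₁ (o I i j) (u I i j) ⟩
        (x₁₁ - x) * o I i j + (x - x₁₁) * u I i j
          ≈⟨ +-congʳ (*-congʳ (≈-from (trans (+-congˡ (-‿cong (sym (θ-in t d)))) (-‿inverseʳ x))
               (solve 4 (λ x y p q → y :- x := p :+ q :- x :- x :+ (x :- (p :+ q :- y))) refl x
                   x₁₁ x₁₀ x₀₁))) ⟩
        (x₁₀ + x₀₁ - x - x) * o I i j + (x - x₁₁) * u I i j ∎
        where
        x   = θ t i j
        x₁₀ = θ t (suc i) j
        x₀₁ = θ t i (suc j)
        x₁₁ = θ t (suc i) (suc j)

    module _ {a : Carrier} {b c : Vector Carrier size}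
             (eq : ∀ I → affine a b I ≈ sum λ p → c p * 𝒯⁻ p I) where

      private
        ĉ : ℕ → ℕ → Carrier
        ĉ = ext c

      open Relations a b ĉ (λ i j → - ĉ i j) (λ I → trans (eq I) (trans
        (sum-ext c (𝒯⁻≈ I) (λ i j d∉ →
            trans (+-cong (o-out I d∉) (-‿cong (u-out I d∉))) (-‿inverseʳ 0#)))
        (□-cong height width λ i j →
            solve 3 (λ c o u → c :* (o :- u) := c :* o :+ (:- c) :* u) refl _ _ _)))

      private
        -- Extension by zero need not satisfy the recurrence near the border. The value of `b̃` at
        -- (i + 1 , j + 1) is the one for which the coefficients of `u` at (i , j) agree; on λ it is
        -- that of `b̂`, and beyond a border cell other than a corner it is the free parameter.
        d̂ b̃ : ℕ → ℕ → Carrier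
        d̂ i j = b̂ i j + ĉ i j
        b̃ zero    j       = b̂ 0 j
        b̃ (suc i) zero    = b̂ (suc i) 0
        b̃ (suc i) (suc j) = d̂ i j

        t : Params
        t k = d̂ (srow k) (scol k)

        diagonal-step : ∀ {i j} → Inner i j → d̂ i j ≈ b̂ (suc i) (suc j)
        diagonal-step inner = ≈-from (second-order inner)
          (solve 3 (λ x y c → x :+ c := y :+ (x :- y :- (:- c))) refl _ _ _)

        b̃≈b̂ : ∀ i j → D i j → b̃ i j ≈ b̂ i j
        b̃≈b̂ zero    j       d = refl
        b̃≈b̂ (suc i) zero    d = refl
        b̃≈b̂ (suc i) (suc j) d =
            diagonal-step (D-down ≤-refl (n≤1+n j) d , D-down (n≤1+n i) ≤-refl d)

        -- The `e` terms of `first-order` replace `b̂` by `b̃` at the two successors. On an axis one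
        -- `e` term is missing, just where `b̃` and `b̂` coincide by definition.
        recurrence : ∀ i j → D i j → b̃ (suc i) j + b̃ i (suc j) - d̂ i j ≈ b̂ i j
        recurrence zero    zero    d = ≈-from (first-order 0 0 d)
          (solve 4 (λ x p q c → p :+ q :- (x :+ c) :=
              x :+ ((p :+ q :- x :- x :- c) :+ (con (+ 0) :+ con (+ 0)))) refl
            (b̂ 0 0) (b̂ 1 0) (b̂ 0 1) (ĉ 0 0))
        recurrence zero    (suc j) d = ≈-from (first-order 0 (suc j) d)
          (solve 6 (λ x p q c y c′ → (y :+ c′) :+ q :- (x :+ c) :=
              x :+ ((p :+ q :- x :- x :- c) :+ (con (+ 0) :+ (y :- p :- (:- c′))))) refl
            (b̂ 0 (suc j)) (b̂ 1 (suc j)) (b̂ 0 (2 ℕ.+ j)) (ĉ 0 (suc j)) (b̂ 0 j) (ĉ 0 j))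
        recurrence (suc i) zero    d = ≈-from (first-order (suc i) 0 d)
          (solve 6 (λ x p q c y c′ → p :+ (y :+ c′) :- (x :+ c) :=
              x :+ ((p :+ q :- x :- x :- c) :+ ((y :- q :- (:- c′)) :+ con (+ 0)))) refl
            (b̂ (suc i) 0) (b̂ (2 ℕ.+ i) 0) (b̂ (suc i) 1) (ĉ (suc i) 0) (b̂ i 0) (ĉ i 0))
        recurrence (suc i) (suc j) d = ≈-from (first-order (suc i) (suc j) d)
          (solve 8 (λ x p q c y c′ z c″ → (z :+ c″) :+ (y :+ c′) :- (x :+ c) :=
              x :+ ((p :+ q :- x :- x :- c) :+ ((y :- q :- (:- c′)) :+ (z :- p :- (:- c″))))) refl
            (b̂ (suc i) (suc j)) (b̂ (2 ℕ.+ i) (suc j)) (b̂ (suc i) (2 ℕ.+ j)) (ĉ (suc i) (suc j))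
            (b̂ i (suc j)) (ĉ i (suc j)) (b̂ (suc i) j) (ĉ (suc i) j))

        θ≈b̃-out : ∀ i j → Near i j → ¬ D i j → θ t i j ≈ b̃ i j
        θ≈b̃-out zero    j       _ d∉ = trans (θ-row t d∉) (sym (ext-out b d∉))
        θ≈b̃-out (suc i) zero    _ d∉ = trans (θ-column t d∉) (sym (ext-out b d∉))
        θ≈b̃-out (suc i) (suc j) d d∉ =
            trans (θ-out t d∉) (trans (sym (β-diagonal t i j)) (border (inner? i j)))
          where
          border : Dec (Inner i j) → β t i j ≈ d̂ i j
          border (yes inner) = trans (β-corner t (d , d∉) inner)
              (sym (trans (diagonal-step inner) (ext-out b d∉)))
          border (no outer)  = β-outer t d̂ (λ k → refl) (d , d∉) outer

        -- Both sides obey the same recurrence on λ and agree just outside it, so the equality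
        -- spreads inwards.
        θ≈b̃ : ∀ n i j → Near i j → Fuel n i j → θ t i j ≈ b̃ i j
        θ≈b̃ zero    i j near enough = θ≈b̃-out i j near (fuel-zero {i} {j} enough)
        θ≈b̃ (suc n) i j near enough = by-cases (D? i j)
          where
          by-cases : Dec (D i j) → θ t i j ≈ b̃ i j
          by-cases (no d∉) = θ≈b̃-out i j near d∉
          by-cases (yes d) = trans (θ-in t d) (trans
            (+-cong (+-cong (θ≈b̃ n (suc i) j (near₁₀ i j d) (fuel₁₀ {n} {i} {j} enough))
                            (θ≈b̃ n i (suc j) (near₀₁ i j d) (fuel₀₁ {n} {i} {j} enough)))
                    (-‿cong (θ≈b̃ n (suc i) (suc j) d (fuel₁₁ {n} {i} {j} enough))))
            (trans (recurrence i j d) (sym (b̃≈b̂ i j d))))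

        near-D : ∀ i j → D i j → Near i j
        near-D zero    j       d = tt
        near-D (suc i) zero    d = tt
        near-D (suc i) (suc j) d = D-down (n≤1+n i) (n≤1+n j) d

      onto : ∃ λ t → ∀ I → affine a b I ≈ Φ (θ t) I
      onto = t , affine≈Φ {a} {b} constant-term (θ-addable t) λ i j d →
        trans (sym (b̃≈b̂ i j d))
            (sym (θ≈b̃ (height ℕ.+ width) i j (near-D i j d) (ℕ.m≤n+m _ (i ℕ.+ j))))

-- The two dimensions

theorem3p16 : ∀ {c ℓ₁ ℓ₂ ℓ₃} (ℝ : RealField c ℓ₁ ℓ₂ ℓ₃) (lam : Partition) →
    let open Ferrers lam
        open Toggleability ℝ 𝒫
        open LinearAlgebra ℝ
        N = length borderStrip
        C = length corners
    in HasDimension I_T (N ∸ C) × HasDimension A_T (N ∸ C)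
theorem3p16 ℝ lam =
    ≡.subst (HasDimension I_T) (≡.sym length-strip)
      (hasDimension (λ t → Φ (β t)) (Φ-linear β β-linear) IdealSpace.injective
        (λ ((c , f≈c) , (a , f≈a)) →
          let t , a≈Φ = IdealSpace.onto {a zero} {a ∘ suc} {c} λ I → trans (sym (f≈a I)) (f≈c I)
          in t , λ I → trans (f≈a I) (a≈Φ I))
        (λ t f≈ → let c , Φ≈c = IdealSpace.into t in
          -- `Φ` unfolds to a combination of the constant and the toggles, so `f≈` itself proves the
          -- second membership.
          (c , λ I → trans (f≈ I) (Φ≈c I)) , (_ ∷ᵛ _ , f≈)))
  , ≡.subst (HasDimension A_T) (≡.sym length-strip)
      (hasDimension (λ t → Φ (θ t)) (Φ-linear θ λ i j → γ-linear (height ℕ.+ width) i j)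
        AntichainSpace.injective
        (λ ((c , f≈c) , (a , f≈a)) →
          let t , a≈Φ = AntichainSpace.onto {a zero} {a ∘ suc} {c} λ I → trans (sym (f≈a I)) (f≈c I)
          in t , λ I → trans (f≈a I) (a≈Φ I))
        (λ t f≈ → let c , Φ≈c = AntichainSpace.into t in
          (c , λ I → trans (f≈ I) (Φ≈c I)) , (_ ∷ᵛ _ , f≈)))
  where
  open RealField ℝ using (trans; sym; commutativeRing)
  open RealFieldProperties ℝ using (torsionFree; hasDimension)
  open Diagram lam using (height; width; length-strip)
  open Ferrers lam using (𝒫)
  open Toggleability ℝ 𝒫 using (I_T; A_T)
  open LinearAlgebra ℝ using (HasDimension)
  open ToggleabilitySpaces commutativeRing torsionFree lam
  open AntichainSpace using (θ; γ-linear)
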